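{- Let $M$ be a $\lambda$-term. If $\Phi\rhd[x_1:(\vec\tau_1,\vec t_1),\dots,x_n:(\vec\tau_n,\vec t_n)]\vdash^{b}M:(\sigma,s)$, then $\mathsf{T_Q}(M)=(\Gamma',\sigma',b')$ for some $\mathbb{T}_{L1}$-environment $\Gamma'$, type $\sigma'$ and measure $b'$, and there is a type substitution $\mathbb{S}$ such that $\mathbb{S}(\sigma')=\sigma$ and $\mathbb{S}(\Gamma')\equiv[x_1:\vec\tau_1,\dots,x_n:\vec\tau_n]$.
   Context: Terms are untyped $\lambda$-terms modulo $\alpha$-equivalence, with Barendregt's variable convention. $M[N/x]$ is the usual substitution, and $M[x/x_1,x/x_2]$ means $(M[x/x_1])[x/x_2]$. **Types.** $\mathbb{V}$ is a countably infinite set of type variables $\alpha$. Linear types $\tau\in\mathbb{T}_{L0}$: $\tau::=\alpha\mid\tau\multimap\tau$. Sequences $\vec\tau\in\mathbb{T}_{L1}$: $\tau_1\cap\dots\cap\tau_m$, $m\ge1$. Linear rank 2 types $\sigma\in\mathbb{T}_{L2}$: $\sigma::=\tau\mid\tau\multimap\sigma\mid\tau_1\cap\dots\cap\tau_m\to\sigma$ with $m\ge2$. Multi-types: tight constants $\mathsf{tight}::=\mathsf{Neutral}\mid\mathsf{Abs}$; rank 0: $t::=\mathsf{tight}\mid\alpha\mid t\multimap t$; rank 1: $\vec t::=t\mid\vec t\cap\vec t$; rank 2: $s::=t\mid t\multimap s\mid\vec t\to s$. The constructor $\cap$ is associative, commutative and non-idempotent. $\mathsf{tight}(t_1\cap\dots\cap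 t_n)$ holds iff every $t_i$ is a tight constant. **Environments.** An environment is a finite list $\Gamma=[x_1:(\vec\tau_1,\vec t_1),\dots,x_n:(\vec\tau_n,\vec t_n)]$ with pairwise distinct variables $x_i$ (consistency), $\mathrm{dom}(\Gamma)=\{x_1,\dots,x_n\}$. A $\mathbb{T}_{L1}$-environment is the same with only the first components: $[x_1:\vec\tau_1,\dots,x_n:\vec\tau_n]$. Comma is list concatenation; $\equiv$ is equality up to the order of declarations. $\Gamma_x$ is $\Gamma$ with the declaration of $x$ (if any) removed. $\Gamma_1+\Gamma_2$ has domain $\mathrm{dom}(\Gamma_1)\cup\mathrm{dom}(\Gamma_2)$, agrees with $\Gamma_1$ (resp. $\Gamma_2$) on variables declared only there, and for $x$ declared in both intersects the predicates componentwise ($(\vec\tau_1\cap\vec\tau_2,\vec t_1\cap\vec t_2)$, resp. $\vec\tau_1\cap\vec\tau_2$ for $\mathbb{T}_{L1}$-environments); declarations of variables of $\Gamma_1$ come first in their order, then the remaining ones in the order of $\Gamma_2$. $\sum$ is iterated $+$. **Linear Rank 2 Quantitative Type System.** Judgments $\Gamma\vdash^{b}M:(\sigma,s)$, $b\in\mathbb{N}$, are derived by the following rules (all lists must be environments; each occurrence of $\mathsf{tight}$ stands for some tight constant); $\Phi\rhd\Gamma\vdash^bM:(\sigma,s)$ means that $\Phi$ is a derivation tree ending with that judgment: - (Axiom) $[x:(\tau,t)]\vdash^0x:(\tau,t)$. - (Exchange) two adjacent declarations of the environment may be swapped, keeping $b,M,\sigma,s$. - (Contraction) from $\Gamma_1,x_1:(\vec\tau_1,\vec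 t_1),x_2:(\vec\tau_2,\vec t_2),\Gamma_2\vdash^bM:(\sigma,s)$ infer $\Gamma_1,x:(\vec\tau_1\cap\vec\tau_2,\vec t_1\cap\vec t_2),\Gamma_2\vdash^bM[x/x_1,x/x_2]:(\sigma,s)$. - ($\multimap$ Intro) from $\Gamma,x:(\tau,t)\vdash^bM:(\sigma,s)$ infer $\Gamma\vdash^{b+1}\lambda x.M:(\tau\multimap\sigma,t\multimap s)$. - ($\multimap$ Intro$_t$) from $\Gamma,x:(\tau,\mathsf{tight})\vdash^bM:(\sigma,\mathsf{tight})$ infer $\Gamma\vdash^b\lambda x.M:(\tau\multimap\sigma,\mathsf{Abs})$. - ($\to$ Intro) from $\Gamma,x:(\tau_1\cap\dots\cap\tau_n,t_1\cap\dots\cap t_n)\vdash^bM:(\sigma,s)$, $n\ge2$, infer $\Gamma\vdash^{b+1}\lambda x.M:(\tau_1\cap\dots\cap\tau_n\to\sigma,t_1\cap\dots\cap t_n\to s)$. - ($\to$ Intro$_t$) from $\Gamma,x:(\tau_1\cap\dots\cap\tau_n,\vec t)\vdash^bM:(\sigma,\mathsf{tight})$, $\mathsf{tight}(\vec t)$, $n\ge2$, infer $\Gamma\vdash^b\lambda x.M:(\tau_1\cap\dots\cap\tau_n\to\sigma,\mathsf{Abs})$. - ($\multimap$ Elim) from $\Gamma_1\vdash^{b_1}M_1:(\tau\multimap\sigma,t\multimap s)$ and $\Gamma_2\vdash^{b_2}M_2:(\tau,t)$ infer $\Gamma_1,\Gamma_2\vdash^{b_1+b_2}M_1M_2:(\sigma,s)$.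 - ($\multimap$ Elim$_t$) from $\Gamma_1\vdash^{b_1}M_1:(\tau\multimap\sigma,\mathsf{Neutral})$ and $\Gamma_2\vdash^{b_2}M_2:(\tau,\mathsf{tight})$ infer $\Gamma_1,\Gamma_2\vdash^{b_1+b_2}M_1M_2:(\sigma,\mathsf{Neutral})$. - ($\to$ Elim) from $\Gamma\vdash^bM_1:(\tau_1\cap\dots\cap\tau_n\to\sigma,t_1\cap\dots\cap t_n\to s)$ and $\Gamma_i\vdash^{b_i}M_2:(\tau_i,t_i)$ for $1\le i\le n$, $n\ge2$, infer $\Gamma,\sum_{i=1}^n\Gamma_i\vdash^{b+b_1+\dots+b_n}M_1M_2:(\sigma,s)$. - ($\to$ Elim$_t$) from $\Gamma\vdash^bM_1:(\tau_1\cap\dots\cap\tau_n\to\sigma,\mathsf{Neutral})$ and $\Gamma_i\vdash^{b_i}M_2:(\tau_i,\mathsf{tight})$ for $1\le i\le n$, $n\ge2$, infer $\Gamma,\sum_{i=1}^n\Gamma_i\vdash^{b+b_1+\dots+b_n}M_1M_2:(\sigma,\mathsf{Neutral})$. **Type substitutions and quantitative unification.** A type substitution $\mathbb{S}=[\tau_1/\alpha_1,\dots,\tau_n/\alpha_n]$ (distinct $\alpha_i$, $\tau_i\in\mathbb{T}_{L0}$) acts by simultaneous replacement on types, sequences and $\mathbb{T}_{L1}$-environments. A unification problem $P$ is a finite set of equations between types of $\mathbb{T}_{L0}$. The relation $\Rightarrow$ is: $\{\tau=\tau\}\cup P\Rightarrow P$; (*) $\{\tau_1\multimap\tau_2=\tau_3\multimap\tau_4\}\cup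 P\Rightarrow\{\tau_1=\tau_3,\tau_2=\tau_4\}\cup P$; $\{\tau_1\multimap\tau_2=\alpha\}\cup P\Rightarrow\{\alpha=\tau_1\multimap\tau_2\}\cup P$; $\{\alpha=\tau\}\cup P\Rightarrow\{\alpha=\tau\}\cup P[\tau/\alpha]$ if $\alpha$ occurs in $P$ and not in $\tau$; $\{\alpha=\tau\}\cup P\Rightarrow\mathsf{FAIL}$ if $\alpha$ occurs in $\tau$ and $\alpha\ne\tau$. $\mathsf{UNIFY_Q}(P)$ applies $\Rightarrow$ as long as possible, counting in $b$ the number of steps of form (*); if the result is a solved form $\{\alpha_1=\tau_1,\dots,\alpha_n=\tau_n\}$ ($\alpha_i$ pairwise distinct, occurring in no $\tau_j$) it returns $([\tau_1/\alpha_1,\dots,\tau_n/\alpha_n],b)$ (the substitution being a most general unifier of the original problem), otherwise it fails. **Quantitative type inference algorithm $\mathsf{T_Q}$**, returning a $\mathbb{T}_{L1}$-environment, a type in $\mathbb{T}_{L2}$ and a measure. "New" type variables are fresh; separate recursive calls use different fresh variables; results are considered up to renaming of type variables. 1. $\mathsf{T_Q}(x)=([x:\alpha],\alpha,0)$, $\alpha$ new. 2. If $M=\lambda x.M_1$ and $\mathsf{T_Q}(M_1)=(\Gamma_1,\sigma_1,b_1)$: (a) if $x\notin\mathrm{dom}(\Gamma_1)$, fail; (b) if $(x:\tau)\in\Gamma_1$, $\mathsf{T_Q}(M)=((\Gamma_1)_x,\tau\multimap\sigma_1,b_1)$; (c) if $(x:\tau_1\cap\dots\cap\tau_n)\in\Gamma_1$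 with $n\ge2$, $\mathsf{T_Q}(M)=((\Gamma_1)_x,\tau_1\cap\dots\cap\tau_n\to\sigma_1,b_1)$. 3. If $M=M_1M_2$: (a) if $\mathsf{T_Q}(M_1)=(\Gamma_1,\alpha_1,b_1)$ and $\mathsf{T_Q}(M_2)=(\Gamma_2,\tau_2,b_2)$, then $\mathsf{T_Q}(M)=(\mathbb{S}(\Gamma_1+\Gamma_2),\mathbb{S}(\alpha_3),b_1+b_2)$ with $(\mathbb{S},\_)=\mathsf{UNIFY_Q}(\{\alpha_1=\alpha_2\multimap\alpha_3,\tau_2=\alpha_2\})$, $\alpha_2,\alpha_3$ new; (b) if $\mathsf{T_Q}(M_1)=(\Gamma_1',\tau_1'\cap\dots\cap\tau_n'\to\sigma_1',b_1)$ with $n\ge2$ and, for each $1\le i\le n$, $\mathsf{T_Q}(M_2)=(\Gamma_i,\tau_i,b_i)$ ($n$ separate calls), then $\mathsf{T_Q}(M)=(\mathbb{S}(\Gamma_1'+\sum_{i=1}^n\Gamma_i),\mathbb{S}(\sigma_1'),b_1+\sum_{i=1}^nb_i+b_3+1)$ with $(\mathbb{S},b_3)=\mathsf{UNIFY_Q}(\{\tau_i=\tau_i'\mid1\le i\le n\})$ (here the first summand $b_1$ is the measure of $M_1$, the $b_i$ in the sum are those of the calls on $M_2$, and $b_3$ is the unification count); (c) if $\mathsf{T_Q}(M_1)=(\Gamma_1,\tau\multimap\sigma_1,b_1)$ and $\mathsf{T_Q}(M_2)=(\Gamma_2,\tau_2,b_2)$, then $\mathsf{T_Q}(M)=(\mathbb{S}(\Gamma_1+\Gamma_2),\mathbb{S}(\sigma_1),b_1+b_2+b_3+1)$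 with $(\mathbb{S},b_3)=\mathsf{UNIFY_Q}(\{\tau_2=\tau\})$; (d) otherwise fail. If a recursive call or a unification fails, the algorithm fails. $\mathsf{T_Q}(M)=(\Gamma,\sigma,b)$ means that the algorithm succeeds with this result. -}

module Defs where

open import Data.Bool.Base using (if_then_else_)
open import Data.Fin.Base using (Fin; inject₁; fromℕ)
open import Data.List.Base as List using (List; []; _∷_; _++_; _∷ʳ_; filter)
open import Data.List.Membership.Propositional using (_∈_; _∉_)
open import Data.List.Membership.DecPropositional using () renaming (_∈?_ to mem?)
open import Data.List.NonEmpty.Base as List⁺ using (List⁺; [_]; _⁺++⁺_; fromVec; toList)
open import Data.List.Relation.Binary.BagAndSetEquality using (_∼[_]_; set)
open import Data.List.Relation.Binary.Permutation.Homogeneous using (Permutation)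
open import Data.List.Relation.Binary.Permutation.Propositional using (_↭_)
open import Data.List.Relation.Binary.Pointwise using (Pointwise)
open import Data.List.Relation.Unary.All using (All)
open import Data.List.Relation.Unary.Any using (Any)
open import Data.List.Relation.Unary.Unique.Propositional using (Unique)
open import Data.Maybe.Base using (Maybe; just; nothing; maybe; fromMaybe)
open import Data.Nat.Base using (ℕ; suc; _+_)
open import Data.Nat.Properties using (_≟_)
open import Data.Product using (_×_; _,_; proj₁; proj₂; ∃-syntax; map₂)
open import Data.Sum.Base using (_⊎_)
open import Data.Vec.Base as Vec using (Vec; []; _∷_; lookup)
open import Relation.Binary.PropositionalEquality using (_≡_; _≢_)
open import Relation.Nullary using (¬_; ¬?; does)

Var TVar : Set
Var  = ℕ
TVar = ℕ

-- λ-terms modulo α-equivalence, in locally nameless form: free variables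
-- are names, and bound variables are well-scoped de Bruijn indices, so
-- that propositional equality is α-equivalence.

data Term (n : ℕ) : Set where
  free  : Var → Term n
  bound : Fin n → Term n
  lam   : Term (suc n) → Term n
  _·_   : Term n → Term n → Term n

infixl 9 _·_

Λ : Set
Λ = Term 0

-- The new binder is outermost, hence has the largest index.
close : ∀ {n} → Var → Term n → Term (suc n)
close {n} x (free y) = if does (x ≟ y) then bound (fromℕ n) else free y
close x (bound i)    = bound (inject₁ i)
close x (lam M)      = lam (close x M)
close x (M · N)      = close x M · close x N

-- ƛ x M is the named abstraction λx.M.
ƛ : Var → Λ → Λ
ƛ x M = lam (close x M)

-- Substitution of a variable for a free variable.  No capture can occur.
infix 10 _[_/_]

_[_/_] : ∀ {n} → Term n → Var → Var → Term n
free z  [ y / x ] = if does (z ≟ x) then free y else free z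
bound i [ y / x ] = bound i
lam M   [ y / x ] = lam (M [ y / x ])
(M · N) [ y / x ] = (M [ y / x ]) · (N [ y / x ])

infixr 6 _⊸_ _⇒_

data L₀ : Set where
  tv  : TVar → L₀
  _⊸_ : L₀ → L₀ → L₀

-- Sequences τ₁ ∩ … ∩ τₘ, with m ≥ 1; they are compared up to permutation.
L₁ : Set
L₁ = List⁺ L₀

-- Every τ is of the form τ₁ ⊸ … ⊸ τₖ ⊸ α, so the grammar
-- σ ::= τ | τ ⊸ σ | τ₁ ∩ … ∩ τₘ → σ generates the same types as
-- σ ::= α | τ ⊸ σ | τ₁ ∩ … ∩ τₘ → σ, but the latter is unambiguous.
data L₂ : Set where
  tv  : TVar → L₂
  _⊸_ : L₀ → L₂ → L₂
  _⇒_ : ∀ {n} → Vec L₀ (2 + n) → L₂ → L₂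

⌈_⌉ : L₀ → L₂
⌈ tv α ⌉   = tv α
⌈ τ ⊸ τ′ ⌉ = τ ⊸ ⌈ τ′ ⌉

data Tight : Set where
  Neutral Abs : Tight

data Q₀ : Set where
  tight : Tight → Q₀
  tv    : TVar → Q₀
  _⊸_   : Q₀ → Q₀ → Q₀

Q₁ : Set
Q₁ = List⁺ Q₀

-- The unambiguous form of s ::= t | t ⊸ s | t⃗ → s, as for L₂.
data Q₂ : Set where
  tight : Tight → Q₂
  tv    : TVar → Q₂
  _⊸_   : Q₀ → Q₂ → Q₂
  _⇒_   : Q₁ → Q₂ → Q₂

⌈_⌉ᵠ : Q₀ → Q₂
⌈ tight c ⌉ᵠ = tight c
⌈ tv α ⌉ᵠ    = tv α
⌈ t ⊸ t′ ⌉ᵠ  = t ⊸ ⌈ t′ ⌉ᵠ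

data IsTight : Q₀ → Set where
  tight : ∀ c → IsTight (tight c)

AllTight : Q₁ → Set
AllTight t⃗ = All IsTight (toList t⃗)

-- Equality of types: ∩ is associative, commutative and non-idempotent.

infix 4 _≈₁_ _≈₂_ _≈ᵠ_

_≈₁_ : {A : Set} → List⁺ A → List⁺ A → Set
τ⃗ ≈₁ τ⃗′ = toList τ⃗ ↭ toList τ⃗′

data _≈₂_ : L₂ → L₂ → Set where
  tv  : ∀ {α} → tv α ≈₂ tv α
  _⊸_ : ∀ τ {σ σ′} → σ ≈₂ σ′ → τ ⊸ σ ≈₂ τ ⊸ σ′
  _⇒_ : ∀ {m n} {τs : Vec L₀ (2 + m)} {τs′ : Vec L₀ (2 + n)} {σ σ′} →
        fromVec τs ≈₁ fromVec τs′ → σ ≈₂ σ′ → τs ⇒ σ ≈₂ τs′ ⇒ σ′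

data _≈ᵠ_ : Q₂ → Q₂ → Set where
  tight : ∀ {c} → tight c ≈ᵠ tight c
  tv    : ∀ {α} → tv α ≈ᵠ tv α
  _⊸_   : ∀ t {s s′} → s ≈ᵠ s′ → t ⊸ s ≈ᵠ t ⊸ s′
  _⇒_   : ∀ {t⃗ t⃗′ s s′} → t⃗ ≈₁ t⃗′ → s ≈ᵠ s′ → t⃗ ⇒ s ≈ᵠ t⃗′ ⇒ s′

-- Lists of declarations; the keys are term variables in environments
-- and type variables in type substitutions.
Decls : Set → Set
Decls A = List (ℕ × A)

dom : {A : Set} → Decls A → List ℕ
dom = List.map proj₁

Consistent : {A : Set} → Decls A → Set
Consistent Γ = Unique (dom Γ)

find : {A : Set} → ℕ → Decls A → Maybe A
find x []            = nothing
find x ((y , a) ∷ Γ) = if does (x ≟ y) then just a else find x Γ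

remove : {A : Set} → ℕ → Decls A → Decls A
remove x = filter (λ d → ¬? (x ≟ proj₁ d))

-- Γ₁ + Γ₂, given the operation that intersects two predicates.
merge : {A : Set} → (A → A → A) → Decls A → Decls A → Decls A
merge _∩_ Γ₁ Γ₂ =
  List.map (λ (x , a) → x , maybe (a ∩_) a (find x Γ₂)) Γ₁ ++
  filter (λ d → ¬? (mem? _≟_ (proj₁ d) (dom Γ₁))) Γ₂

Env Env₁ : Set
Env  = Decls (L₁ × Q₁)
Env₁ = Decls L₁

infixl 6 _⊕_ _⊕₁_

_⊕_ : Env → Env → Env
_⊕_ = merge (λ (τ⃗₁ , t⃗₁) (τ⃗₂ , t⃗₂) → τ⃗₁ ⁺++⁺ τ⃗₂ , t⃗₁ ⁺++⁺ t⃗₂)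

_⊕₁_ : Env₁ → Env₁ → Env₁
_⊕₁_ = merge _⁺++⁺_

⨁ : ∀ {n} → Vec Env (suc n) → Env
⨁ = Vec.foldr₁ _⊕_

⨁₁ : ∀ {n} → Vec Env₁ (suc n) → Env₁
⨁₁ = Vec.foldr₁ _⊕₁_

-- The T_L1-environment underlying an environment.
linear : Env → Env₁
linear = List.map (map₂ proj₁)

-- Equality of environments, keeping the order of declarations.
infix 4 _≈ᴱ_ _≡ᴱ_

_≈ᴱ_ : Env → Env → Set
_≈ᴱ_ = Pointwise λ (x , τ⃗ , t⃗) (x′ , τ⃗′ , t⃗′) → x ≡ x′ × τ⃗ ≈₁ τ⃗′ × t⃗ ≈₁ t⃗′

-- Equality of T_L1-environments up to the order of declarations.
_≡ᴱ_ : Env₁ → Env₁ → Set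
_≡ᴱ_ = Permutation λ (x , τ⃗) (x′ , τ⃗′) → x ≡ x′ × τ⃗ ≈₁ τ⃗′

-- Consistency is a premise only of the rules that do not preserve it, so
-- the environments of derivable judgments are always consistent.  Since
-- types are represented by lists, `conv` identifies the representatives
-- of the same types modulo the laws of ∩; in particular, the two components
-- of a predicate can be permuted independently.

infix 3 _⊢[_]_∶_

data _⊢[_]_∶_ : Env → ℕ → Λ → L₂ × Q₂ → Set where

  conv : ∀ {Γ Γ′ b M σ σ′ s s′} →
    Γ ⊢[ b ] M ∶ (σ , s) →
    Γ ≈ᴱ Γ′ → σ ≈₂ σ′ → s ≈ᵠ s′ →
    Γ′ ⊢[ b ] M ∶ (σ′ , s′)

  axiom : ∀ {x τ t} →
    (x , [ τ ] , [ t ]) ∷ [] ⊢[ 0 ] free x ∶ (⌈ τ ⌉ , ⌈ t ⌉ᵠ)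

  exchange : ∀ {Γ₁ d₁ d₂ Γ₂ b M σ s} →
    Γ₁ ++ d₁ ∷ d₂ ∷ Γ₂ ⊢[ b ] M ∶ (σ , s) →
    Γ₁ ++ d₂ ∷ d₁ ∷ Γ₂ ⊢[ b ] M ∶ (σ , s)

  contraction : ∀ {Γ₁ Γ₂ x₁ x₂ x τ⃗₁ τ⃗₂ t⃗₁ t⃗₂ b M σ s} →
    Γ₁ ++ (x₁ , τ⃗₁ , t⃗₁) ∷ (x₂ , τ⃗₂ , t⃗₂) ∷ Γ₂ ⊢[ b ] M ∶ (σ , s) →
    Consistent (Γ₁ ++ (x , τ⃗₁ ⁺++⁺ τ⃗₂ , t⃗₁ ⁺++⁺ t⃗₂) ∷ Γ₂) →
    Γ₁ ++ (x , τ⃗₁ ⁺++⁺ τ⃗₂ , t⃗₁ ⁺++⁺ t⃗₂) ∷ Γ₂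
      ⊢[ b ] (M [ x / x₁ ]) [ x / x₂ ] ∶ (σ , s)

  ⊸-intro : ∀ {Γ x τ t b M σ s} →
    Γ ∷ʳ (x , [ τ ] , [ t ]) ⊢[ b ] M ∶ (σ , s) →
    Γ ⊢[ suc b ] ƛ x M ∶ (τ ⊸ σ , t ⊸ s)

  ⊸-introₜ : ∀ {Γ x τ c b M σ c′} →
    Γ ∷ʳ (x , [ τ ] , [ tight c ]) ⊢[ b ] M ∶ (σ , tight c′) →
    Γ ⊢[ b ] ƛ x M ∶ (τ ⊸ σ , tight Abs)

  ⇒-intro : ∀ {n Γ x} {τs : Vec L₀ (2 + n)} {ts : Vec Q₀ (2 + n)} {b M σ s} →
    Γ ∷ʳ (x , fromVec τs , fromVec ts) ⊢[ b ] M ∶ (σ , s) →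
    Γ ⊢[ suc b ] ƛ x M ∶ (τs ⇒ σ , fromVec ts ⇒ s)

  ⇒-introₜ : ∀ {n Γ x} {τs : Vec L₀ (2 + n)} {t⃗ b M σ c} →
    Γ ∷ʳ (x , fromVec τs , t⃗) ⊢[ b ] M ∶ (σ , tight c) →
    AllTight t⃗ →
    Γ ⊢[ b ] ƛ x M ∶ (τs ⇒ σ , tight Abs)

  ⊸-elim : ∀ {Γ₁ Γ₂ b₁ b₂ M₁ M₂ τ t σ s} →
    Γ₁ ⊢[ b₁ ] M₁ ∶ (τ ⊸ σ , t ⊸ s) →
    Γ₂ ⊢[ b₂ ] M₂ ∶ (⌈ τ ⌉ , ⌈ t ⌉ᵠ) →
    Consistent (Γ₁ ++ Γ₂) →
    Γ₁ ++ Γ₂ ⊢[ b₁ + b₂ ] M₁ · M₂ ∶ (σ , s)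

  ⊸-elimₜ : ∀ {Γ₁ Γ₂ b₁ b₂ M₁ M₂ τ c σ} →
    Γ₁ ⊢[ b₁ ] M₁ ∶ (τ ⊸ σ , tight Neutral) →
    Γ₂ ⊢[ b₂ ] M₂ ∶ (⌈ τ ⌉ , tight c) →
    Consistent (Γ₁ ++ Γ₂) →
    Γ₁ ++ Γ₂ ⊢[ b₁ + b₂ ] M₁ · M₂ ∶ (σ , tight Neutral)

  ⇒-elim : ∀ {n Γ} {Γs : Vec Env (2 + n)} {b} {bs : Vec ℕ (2 + n)} {M₁ M₂}
             {τs : Vec L₀ (2 + n)} {ts : Vec Q₀ (2 + n)} {σ s} →
    Γ ⊢[ b ] M₁ ∶ (τs ⇒ σ , fromVec ts ⇒ s) →
    (∀ i → lookup Γs i ⊢[ lookup bs i ] M₂ ∶ (⌈ lookup τs i ⌉ , ⌈ lookup ts i ⌉ᵠ)) →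
    Consistent (Γ ++ ⨁ Γs) →
    Γ ++ ⨁ Γs ⊢[ b + Vec.sum bs ] M₁ · M₂ ∶ (σ , s)

  ⇒-elimₜ : ∀ {n Γ} {Γs : Vec Env (2 + n)} {b} {bs : Vec ℕ (2 + n)} {M₁ M₂}
              {τs : Vec L₀ (2 + n)} {cs : Vec Tight (2 + n)} {σ} →
    Γ ⊢[ b ] M₁ ∶ (τs ⇒ σ , tight Neutral) →
    (∀ i → lookup Γs i ⊢[ lookup bs i ] M₂ ∶ (⌈ lookup τs i ⌉ , tight (lookup cs i))) →
    Consistent (Γ ++ ⨁ Γs) →
    Γ ++ ⨁ Γs ⊢[ b + Vec.sum bs ] M₁ · M₂ ∶ (σ , tight Neutral)

record Subst : Set where
  constructor ⟪_,_⟫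
  field
    bindings : Decls L₀
    distinct : Unique (dom bindings)

open Subst public

apply : Decls L₀ → L₀ → L₀
apply θ (tv α)   = fromMaybe (tv α) (find α θ)
apply θ (τ ⊸ τ′) = apply θ τ ⊸ apply θ τ′

_⟨_⟩₀ : Subst → L₀ → L₀
S ⟨ τ ⟩₀ = apply (bindings S) τ

_⟨_⟩₁ : Subst → L₁ → L₁
S ⟨ τ⃗ ⟩₁ = List⁺.map (S ⟨_⟩₀) τ⃗

_⟨_⟩₂ : Subst → L₂ → L₂
S ⟨ tv α ⟩₂   = ⌈ S ⟨ tv α ⟩₀ ⌉
S ⟨ τ ⊸ σ ⟩₂  = (S ⟨ τ ⟩₀) ⊸ (S ⟨ σ ⟩₂)
S ⟨ τs ⇒ σ ⟩₂ = Vec.map (S ⟨_⟩₀) τs ⇒ (S ⟨ σ ⟩₂)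

_⟨_⟩ᴱ : Subst → Env₁ → Env₁
S ⟨ Γ ⟩ᴱ = List.map (map₂ (S ⟨_⟩₁)) Γ

infix 5 _≐_

data Equation : Set where
  _≐_ : L₀ → L₀ → Equation

-- Unification problems are finite sets, represented by lists up to
-- _∼[ set ]_.
Problem : Set
Problem = List Equation

data _occursIn_ (α : TVar) : L₀ → Set where
  here  : α occursIn tv α
  left  : ∀ {τ τ′} → α occursIn τ → α occursIn (τ ⊸ τ′)
  right : ∀ {τ τ′} → α occursIn τ′ → α occursIn (τ ⊸ τ′)

_occursInEq_ : TVar → Equation → Set
α occursInEq (τ ≐ τ′) = α occursIn τ ⊎ α occursIn τ′

applyEq : Decls L₀ → Equation → Equation
applyEq θ (τ ≐ τ′) = apply θ τ ≐ apply θ τ′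

data State : Set where
  FAIL : State
  ⟨_⟩  : Problem → State

-- P ≗ e ⊎ Q: P is the disjoint union of {e} and Q.  (If e could remain
-- in Q, rewriting e would make no progress.)
_≗_⊎_ : Problem → Equation → Problem → Set
P ≗ e ⊎ Q = P ∼[ set ] (e ∷ Q) × e ∉ Q

infix 3 _⟹[_]_ _⟹*[_]_

-- The index is 1 for the counted step (*), and 0 for the others.
data _⟹[_]_ : Problem → ℕ → State → Set where
  delete : ∀ {P Q τ} →
    P ≗ (τ ≐ τ) ⊎ Q →
    P ⟹[ 0 ] ⟨ Q ⟩
  decompose : ∀ {P Q τ₁ τ₂ τ₃ τ₄} →
    P ≗ (τ₁ ⊸ τ₂ ≐ τ₃ ⊸ τ₄) ⊎ Q →
    P ⟹[ 1 ] ⟨ (τ₁ ≐ τ₃) ∷ (τ₂ ≐ τ₄) ∷ Q ⟩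
  orient : ∀ {P Q τ₁ τ₂ α} →
    P ≗ (τ₁ ⊸ τ₂ ≐ tv α) ⊎ Q →
    P ⟹[ 0 ] ⟨ (tv α ≐ τ₁ ⊸ τ₂) ∷ Q ⟩
  eliminate : ∀ {P Q α τ} →
    P ≗ (tv α ≐ τ) ⊎ Q →
    Any (α occursInEq_) Q → ¬ (α occursIn τ) →
    P ⟹[ 0 ] ⟨ (tv α ≐ τ) ∷ List.map (applyEq ((α , τ) ∷ [])) Q ⟩
  occurs-check : ∀ {P Q α τ} →
    P ≗ (tv α ≐ τ) ⊎ Q →
    α occursIn τ → tv α ≢ τ →
    P ⟹[ 0 ] FAIL

data _⟹*[_]_ : Problem → ℕ → Problem → Set where
  done : ∀ {P} → P ⟹*[ 0 ] P
  step : ∀ {P Q R b b′} → P ⟹[ b ] ⟨ Q ⟩ → Q ⟹*[ b′ ] R → P ⟹*[ b + b′ ] R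

-- P is the solved form corresponding to S.  No step applies to a solved
-- form, so a run ending in one has been carried on as long as possible.
SolvedForm : Problem → Subst → Set
SolvedForm P S =
  P ∼[ set ] List.map (λ (α , τ) → tv α ≐ τ) (bindings S) ×
  All (λ (α , _) → All (λ (_ , τ) → ¬ (α occursIn τ)) (bindings S)) (bindings S)

-- UNIFYQ P S b: UNIFY_Q(P) succeeds with result (S, b).
UNIFYQ : Problem → Subst → ℕ → Set
UNIFYQ P S b = ∃[ P′ ] (P ⟹*[ b ] P′) × SolvedForm P′ S

infix 3 _⊢_↦_⊣_ _⊢_↦*_⊣_

-- V ⊢ M ↦ (Γ , σ , b) ⊣ V′: the call on M succeeds with result (Γ, σ, b),
-- where V and V′ are the type variables used before and after the call;
-- a new type variable is one that has not been used.  This is a relation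
-- because the choices of new variables and of unification steps are free.
-- Failing calls have no result.
-- V ⊢ M ↦* (Γs , τs , bs) ⊣ V′: consecutive separate calls on M succeed,
-- all of them returning types in T_L0.

mutual

  data _⊢_↦_⊣_ : List TVar → Λ → Env₁ × L₂ × ℕ → List TVar → Set where

    var : ∀ {V x α} →
      α ∉ V →
      V ⊢ free x ↦ ((x , [ tv α ]) ∷ [] , tv α , 0) ⊣ α ∷ V

    abs-⊸ : ∀ {V V′ x M₁ Γ₁ σ₁ b₁ τ} →
      V ⊢ M₁ ↦ (Γ₁ , σ₁ , b₁) ⊣ V′ →
      (x , [ τ ]) ∈ Γ₁ →
      V ⊢ ƛ x M₁ ↦ (remove x Γ₁ , τ ⊸ σ₁ , b₁) ⊣ V′

    abs-⇒ : ∀ {n V V′ x M₁ Γ₁ σ₁ b₁} {τs : Vec L₀ (2 + n)} →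
      V ⊢ M₁ ↦ (Γ₁ , σ₁ , b₁) ⊣ V′ →
      (x , fromVec τs) ∈ Γ₁ →
      V ⊢ ƛ x M₁ ↦ (remove x Γ₁ , τs ⇒ σ₁ , b₁) ⊣ V′

    app-var : ∀ {V V₁ V₂ M₁ M₂ Γ₁ Γ₂ α₁ α₂ α₃ τ₂ b₁ b₂ S b₃} →
      V ⊢ M₁ ↦ (Γ₁ , tv α₁ , b₁) ⊣ V₁ →
      V₁ ⊢ M₂ ↦ (Γ₂ , ⌈ τ₂ ⌉ , b₂) ⊣ V₂ →
      α₂ ∉ V₂ → α₃ ∉ α₂ ∷ V₂ →
      UNIFYQ ((tv α₁ ≐ tv α₂ ⊸ tv α₃) ∷ (τ₂ ≐ tv α₂) ∷ []) S b₃ →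
      V ⊢ M₁ · M₂ ↦ (S ⟨ Γ₁ ⊕₁ Γ₂ ⟩ᴱ , S ⟨ tv α₃ ⟩₂ , b₁ + b₂) ⊣ α₃ ∷ α₂ ∷ V₂

    app-⇒ : ∀ {n V V₁ V₂ M₁ M₂ Γ₁′ σ₁′ b₁ S b₃} {τs′ : Vec L₀ (2 + n)}
              {Γs : Vec Env₁ (2 + n)} {τs : Vec L₀ (2 + n)} {bs : Vec ℕ (2 + n)} →
      V ⊢ M₁ ↦ (Γ₁′ , τs′ ⇒ σ₁′ , b₁) ⊣ V₁ →
      V₁ ⊢ M₂ ↦* (Γs , τs , bs) ⊣ V₂ →
      UNIFYQ (Vec.toList (Vec.zipWith _≐_ τs τs′)) S b₃ →
      V ⊢ M₁ · M₂ ↦ (S ⟨ Γ₁′ ⊕₁ ⨁₁ Γs ⟩ᴱ , S ⟨ σ₁′ ⟩₂ , b₁ + Vec.sum bs + b₃ + 1) ⊣ V₂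

    app-⊸ : ∀ {V V₁ V₂ M₁ M₂ Γ₁ Γ₂ τ σ₁ τ₂ b₁ b₂ S b₃} →
      V ⊢ M₁ ↦ (Γ₁ , τ ⊸ σ₁ , b₁) ⊣ V₁ →
      V₁ ⊢ M₂ ↦ (Γ₂ , ⌈ τ₂ ⌉ , b₂) ⊣ V₂ →
      UNIFYQ ((τ₂ ≐ τ) ∷ []) S b₃ →
      V ⊢ M₁ · M₂ ↦ (S ⟨ Γ₁ ⊕₁ Γ₂ ⟩ᴱ , S ⟨ σ₁ ⟩₂ , b₁ + b₂ + b₃ + 1) ⊣ V₂

  data _⊢_↦*_⊣_ : ∀ {n} → List TVar → Λ →
                  Vec Env₁ n × Vec L₀ n × Vec ℕ n → List TVar → Set where

    [] : ∀ {V M} → V ⊢ M ↦* ([] , [] , []) ⊣ V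

    _∷_ : ∀ {n V V₁ V₂ M Γ τ b} {Γs : Vec Env₁ n} {τs : Vec L₀ n} {bs : Vec ℕ n} →
      V ⊢ M ↦ (Γ , ⌈ τ ⌉ , b) ⊣ V₁ →
      V₁ ⊢ M ↦* (Γs , τs , bs) ⊣ V₂ →
      V ⊢ M ↦* (Γ ∷ Γs , τ ∷ τs , b ∷ bs) ⊣ V₂

-- TQ M ↦ (Γ , σ , b): T_Q(M) = (Γ, σ, b).
infix 3 TQ_↦_

TQ_↦_ : Λ → Env₁ × L₂ × ℕ → Set
TQ M ↦ r = ∃[ V ] [] ⊢ M ↦ r ⊣ V

{-# OPTIONS --safe #-}
module Submission where

-- Splitting each declaration x : τ₁ ∩ … ∩ τₘ into declarations x : τ₁, …, x : τₘ
-- turns environments into multisets of pairs (x , τ).  Intersecting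
-- environments becomes union of multisets, and contraction becomes renaming, so
-- it can be pushed to the leaves of a derivation.  This leaves a syntax-directed
-- system _⊩_∶_, over which one argues by induction: the types in a derivation
-- of an application unify the problem that T_Q poses there, so T_Q succeeds, and
-- a given unifier is unchanged by precomposition with the one that T_Q finds.

open import Defs
open import Data.Bool.Base using (true; false; if_then_else_)
open import Data.Empty using (⊥-elim)
open import Data.Fin.Base using (Fin; zero; suc)
open import Data.List.Base as List using (List; []; _∷_; _++_; _∷ʳ_; filter)
open import Data.List.Membership.DecPropositional using () renaming (_∈?_ to mem?)
open import Data.List.Membership.Propositional using (_∈_; _∉_)
open import Data.List.Membership.Propositional.Properties
  using (∈-map⁺; ∈-map⁻; ∈-++⁻; ∈-++⁺ˡ; ∈-++⁺ʳ; ∈-filter⁻)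
open import Data.List.NonEmpty.Base using (List⁺; _∷_; _⁺++⁺_; fromVec; toList)
open import Data.List.Properties
  using (map-++; map-∘; map-id; map-cong; map-id-local; map-cong-local;
         ++-assoc; ++-identityʳ; filter-++; filter-all; filter-none)
open import Data.List.Relation.Binary.BagAndSetEquality
  using (_∼[_]_; set; [_]-Equality; bag-=⇒; ↭⇒∼bag; ∷-cong)
open import Data.List.Relation.Binary.Disjoint.Propositional using (Disjoint)
open import Data.List.Relation.Binary.Permutation.Homogeneous as Homogeneous using ()
open import Data.List.Relation.Binary.Permutation.Propositional as ↭
  using (_↭_; ↭-refl; ↭-sym; ↭-trans; ↭-reflexive; ↭⇒↭ₛ; module PermutationReasoning)
open import Data.List.Relation.Binary.Permutation.Propositional.Properties as ↭ using ()
import Data.List.Relation.Binary.Permutation.Setoid.Properties as SetoidPermutation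
open import Data.List.Relation.Binary.Pointwise using ([]; _∷_)
open import Data.List.Relation.Binary.Subset.Propositional using (_⊆_)
open import Data.List.Relation.Unary.All as All using (All; []; _∷_)
open import Data.List.Relation.Unary.All.Properties as All using (¬Any⇒All¬)
open import Data.List.Relation.Unary.AllPairs using ([]; _∷_)
import Data.List.Relation.Unary.AllPairs.Properties as AllPairs
open import Data.List.Relation.Unary.Any using (Any; here; there; any?)
open import Data.List.Relation.Unary.Unique.Propositional using (Unique)
open import Data.List.Relation.Unary.Unique.Propositional.Properties as Unique
  using (Unique[x∷xs]⇒x∉xs)
open import Data.Maybe.Base using (just; nothing; maybe)
open import Data.Nat.Base using (ℕ; zero; suc; _+_; _≤_; _<_; s≤s; z≤n)
open import Data.Nat.ListAction using (sum)
open import Data.Nat.Properties as ℕ using (_≟_)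
open import Data.Product using (_×_; _,_; proj₁; proj₂; ∃-syntax; map₁; map₂)
open import Data.Sum.Base using (_⊎_; inj₁; inj₂; [_,_]′)
open import Data.Vec.Base as Vec using (Vec; []; _∷_; lookup)
open import Data.Vec.Properties using (toList∘fromList; toList-map)
open import Data.Vec.Relation.Binary.Pointwise.Inductive as Pointwiseᵛ using ([]; _∷_)
open import Function.Base using (_∘_; id)
open import Function.Bundles using (mk⇔)
open import Relation.Binary.Bundles using (Setoid)
open import Relation.Binary.Definitions using (DecidableEquality)
open import Relation.Binary.PropositionalEquality
open import Relation.Nullary using (¬_; ¬?; Dec; yes; no; does)
open import Relation.Nullary.Decidable using (map′; _×-dec_; _⊎-dec_; dec-true; dec-false)
open import Relation.Unary using (Decidable)

-- Syntax-directed typing with multisets of declarations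

-- Contraction can occur anywhere in a derivation and identifies names, so the last rule cannot be
-- read off from the term. Once a variable may be declared repeatedly, identifying names is renaming
-- along an arbitrary, possibly non-injective map, and the premises of an application may share
-- variables. Nothing is lost at the end: a consistent environment is determined, up to order, by
-- its multiset of declarations.
--
-- The substitution demanded by the theorem is never extracted from a most general unifier. Each
-- inferred type is kept together with a substitution `θ` that instantiates it to the derived type.
-- After a unification with result `S` the same `θ` still works, since applying `S` and then `θ`
-- amounts to applying `θ`. Only new type variables make `θ` change, and their values are taken from
-- the derivation.

fresh : (xs : List ℕ) → ∃[ x ] x ∉ xs
fresh xs = suc (sum xs) , λ x∈xs → ℕ.<-irrefl refl (≤sum x∈xs)
  where
  ≤sum : ∀ {x xs} → x ∈ xs → x ≤ sum xs
  ≤sum (here refl) = ℕ.m≤m+n _ _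
  ≤sum {xs = y ∷ xs} (there p) = ℕ.≤-trans (≤sum p) (ℕ.m≤n+m (sum xs) y)

rename : ∀ {n} → (Var → Var) → Term n → Term n
rename ρ (free x)  = free (ρ x)
rename ρ (bound i) = bound i
rename ρ (lam M)   = lam (rename ρ M)
rename ρ (M · N)   = rename ρ M · rename ρ N

_[_≔ᵛ_] : (Var → Var) → Var → Var → Var → Var
(ρ [ x ≔ᵛ y ]) z = if does (z ≟ x) then y else ρ z

≔ᵛ-≡ : ∀ ρ x y → (ρ [ x ≔ᵛ y ]) x ≡ y
≔ᵛ-≡ ρ x y rewrite dec-true (x ≟ x) refl = refl

≔ᵛ-≢ : ∀ ρ {x z} y → z ≢ x → (ρ [ x ≔ᵛ y ]) z ≡ ρ z
≔ᵛ-≢ ρ {x} {z} y z≢x rewrite dec-false (z ≟ x) z≢x = refl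

[/]≡rename : ∀ {n} (M : Term n) {x y} → M [ y / x ] ≡ rename (id [ x ≔ᵛ y ]) M
[/]≡rename (free z) {x} with z ≟ x
... | yes refl rewrite dec-true (z ≟ z) refl = refl
... | no z≢x   rewrite dec-false (z ≟ x) z≢x = refl
[/]≡rename (bound i) = refl
[/]≡rename (lam M)   = cong lam ([/]≡rename M)
[/]≡rename (M · N)   = cong₂ _·_ ([/]≡rename M) ([/]≡rename N)

fv : ∀ {n} → Term n → List Var
fv (free x)  = x ∷ []
fv (bound i) = []
fv (lam M)   = fv M
fv (M · N)   = fv M ++ fv N

-- Lets a renaming pass under a named binder whose name is refreshed to `y`. A free variable `z`
-- other than `x` with `ρ z ≡ y` would be captured by closing over `y`; the hypothesis excludes
-- this.
close-rename : ∀ {n} ρ {x y} (M : Term n) → y ∉ List.map ρ (fv M) →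
  close y (rename (ρ [ x ≔ᵛ y ]) M) ≡ rename ρ (close x M)
close-rename ρ {x} {y} (free z) y∉ with z ≟ x
... | yes refl rewrite dec-true (z ≟ z) refl | dec-true (y ≟ y) refl = refl
... | no z≢x
  rewrite dec-false (z ≟ x) z≢x | dec-false (x ≟ z) (z≢x ∘ sym)
        | dec-false (y ≟ ρ z) (y∉ ∘ here) = refl
close-rename ρ (bound i) y∉ = refl
close-rename ρ (lam M) y∉ = cong lam (close-rename ρ M y∉)
close-rename ρ (M · N) y∉ = cong₂ _·_
  (close-rename ρ M (y∉ ∘ subst (_ ∈_) (sym (map-++ ρ (fv M) (fv N))) ∘ ∈-++⁺ˡ))
  (close-rename ρ N (y∉ ∘ subst (_ ∈_) (sym (map-++ ρ (fv M) (fv N))) ∘ ∈-++⁺ʳ _))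

FlatEnv : Set
FlatEnv = List (Var × L₀)

infix 3 _⊩_∶_ _⊩*_∶_

mutual

  -- Applications concatenate without a disjointness condition, so they do the work of contraction.
  -- The condition `x ∉ dom Δ` forces an abstraction to take every declaration of its variable at
  -- once.
  data _⊩_∶_ : FlatEnv → Λ → L₂ → Set where
    var : ∀ {x τ} → (x , τ) ∷ [] ⊩ free x ∶ ⌈ τ ⌉
    abs-⊸ : ∀ {Δ x M τ σ} →
      Δ ++ (x , τ) ∷ [] ⊩ M ∶ σ → x ∉ dom Δ → Δ ⊩ ƛ x M ∶ τ ⊸ σ
    abs-⇒ : ∀ {n Δ x M σ} {τs : Vec L₀ (2 + n)} →
      Δ ++ List.map (x ,_) (Vec.toList τs) ⊩ M ∶ σ → x ∉ dom Δ → Δ ⊩ ƛ x M ∶ τs ⇒ σ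
    app-⊸ : ∀ {Δ₁ Δ₂ M₁ M₂ τ σ} →
      Δ₁ ⊩ M₁ ∶ τ ⊸ σ → Δ₂ ⊩ M₂ ∶ ⌈ τ ⌉ → Δ₁ ++ Δ₂ ⊩ M₁ · M₂ ∶ σ
    app-⇒ : ∀ {n Δ₁ Δ₂ M₁ M₂ σ} {τs : Vec L₀ (2 + n)} →
      Δ₁ ⊩ M₁ ∶ τs ⇒ σ → Δ₂ ⊩* M₂ ∶ Vec.toList τs → Δ₁ ++ Δ₂ ⊩ M₁ · M₂ ∶ σ
    conv : ∀ {Δ Δ′ M σ σ′} → Δ ⊩ M ∶ σ → Δ ↭ Δ′ → σ ≈₂ σ′ → Δ′ ⊩ M ∶ σ′

  data _⊩*_∶_ : FlatEnv → Λ → List L₀ → Set where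
    []  : ∀ {M} → [] ⊩* M ∶ []
    _∷_ : ∀ {Δ Δ′ M τ τs} → Δ ⊩ M ∶ ⌈ τ ⌉ → Δ′ ⊩* M ∶ τs → Δ ++ Δ′ ⊩* M ∶ τ ∷ τs

renameᴱ : (Var → Var) → FlatEnv → FlatEnv
renameᴱ ρ = List.map (map₁ ρ)

renameᴱ-bind : ∀ ρ {x y Δ} τs → x ∉ dom Δ →
  renameᴱ (ρ [ x ≔ᵛ y ]) (Δ ++ List.map (x ,_) τs) ≡ renameᴱ ρ Δ ++ List.map (y ,_) τs
renameᴱ-bind ρ {x} {y} {Δ} τs x∉Δ = trans (map-++ _ Δ _) (cong₂ _++_
  (map-cong-local (All.tabulate λ {d} d∈Δ → cong (_, proj₂ d)
    (≔ᵛ-≢ ρ y λ { refl → x∉Δ (∈-map⁺ proj₁ d∈Δ) })))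
  (trans (sym (map-∘ τs)) (map-cong (λ τ → cong (_, τ) (≔ᵛ-≡ ρ x y)) τs)))

mutual

  -- `ρ` may identify variables, as contraction requires. A free variable could then be sent to the
  -- name of a binder, so that name is replaced by a `y` outside the images under `ρ` of the body's
  -- free variables and of the declared variables.
  ⊩-rename : ∀ ρ {Δ M σ} → Δ ⊩ M ∶ σ → renameᴱ ρ Δ ⊩ rename ρ M ∶ σ
  ⊩-rename ρ var = var
  ⊩-rename ρ (abs-⊸ {Δ} {x} {M} {τ} D x∉Δ)
    with y , y∉ ← fresh (List.map ρ (fv M) ++ dom (renameᴱ ρ Δ)) =
    subst (λ N → _ ⊩ lam N ∶ _) (close-rename ρ M (y∉ ∘ ∈-++⁺ˡ))
      (abs-⊸ (subst (_⊩ _ ∶ _) (renameᴱ-bind ρ (τ ∷ []) x∉Δ) (⊩-rename (ρ [ x ≔ᵛ y ]) D))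
        (y∉ ∘ ∈-++⁺ʳ _))
  ⊩-rename ρ (abs-⇒ {Δ = Δ} {x} {M} {τs = τs} D x∉Δ)
    with y , y∉ ← fresh (List.map ρ (fv M) ++ dom (renameᴱ ρ Δ)) =
    subst (λ N → _ ⊩ lam N ∶ _) (close-rename ρ M (y∉ ∘ ∈-++⁺ˡ))
      (abs-⇒ (subst (_⊩ _ ∶ _) (renameᴱ-bind ρ (Vec.toList τs) x∉Δ) (⊩-rename (ρ [ x ≔ᵛ y ]) D))
        (y∉ ∘ ∈-++⁺ʳ _))
  ⊩-rename ρ (app-⊸ {Δ₁} {Δ₂} D E) rewrite map-++ (map₁ {C = L₀} ρ) Δ₁ Δ₂ =
    app-⊸ (⊩-rename ρ D) (⊩-rename ρ E)
  ⊩-rename ρ (app-⇒ {Δ₁ = Δ₁} {Δ₂} D E) rewrite map-++ (map₁ {C = L₀} ρ) Δ₁ Δ₂ =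
    app-⇒ (⊩-rename ρ D) (⊩*-rename ρ E)
  ⊩-rename ρ (conv D Δ↭ σ≈) = conv (⊩-rename ρ D) (↭.map⁺ _ Δ↭) σ≈

  ⊩*-rename : ∀ ρ {Δ M τs} → Δ ⊩* M ∶ τs → renameᴱ ρ Δ ⊩* rename ρ M ∶ τs
  ⊩*-rename ρ [] = []
  ⊩*-rename ρ (_∷_ {Δ} {Δ′} D Ds) rewrite map-++ (map₁ {C = L₀} ρ) Δ Δ′ =
    ⊩-rename ρ D ∷ ⊩*-rename ρ Ds

-- From environments to multisets of declarations

module _ {A : Set} where

  remove-∉ : ∀ {x} (Γ : Decls A) → x ∉ dom Γ → remove x Γ ≡ Γ
  remove-∉ {x} Γ x∉ = filter-all (λ d → ¬? (x ≟ proj₁ d)) (All.map⁻ (¬Any⇒All¬ _ x∉))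

  filter-consistent : ∀ {P : ℕ × A → Set} (P? : Decidable P) {Γ} →
    Consistent Γ → Consistent (filter P? Γ)
  filter-consistent P? = AllPairs.map⁺ ∘ AllPairs.filter⁺ P? ∘ AllPairs.map⁻

  find-∉ : ∀ {x} (Γ : Decls A) → x ∉ dom Γ → find x Γ ≡ nothing
  find-∉ []            x∉ = refl
  find-∉ {x} ((y , _) ∷ Γ) x∉ rewrite dec-false (x ≟ y) (x∉ ∘ here) = find-∉ Γ (x∉ ∘ there)

  find-∈ : ∀ {x a} {Γ : Decls A} → Consistent Γ → (x , a) ∈ Γ → find x Γ ≡ just a
  find-∈ {x} c (here refl) rewrite dec-true (x ≟ x) refl = refl
  find-∈ {x} {Γ = (y , _) ∷ Γ} c@(_ ∷ c′) (there p)
    rewrite dec-false (x ≟ y) (λ { refl → Unique[x∷xs]⇒x∉xs c (∈-map⁺ proj₁ p) }) = find-∈ c′ p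

  find-remove : ∀ {x y} (Γ : Decls A) → x ≢ y → find x (remove y Γ) ≡ find x Γ
  find-remove [] x≢y = refl
  find-remove {x} {y} ((z , a) ∷ Γ) x≢y with y ≟ z
  ... | yes refl rewrite dec-true (y ≟ y) refl | dec-false (x ≟ y) x≢y = find-remove Γ x≢y
  ... | no y≢z rewrite dec-false (y ≟ z) y≢z with x ≟ z
  ...   | yes refl rewrite dec-true (x ≟ x) refl = refl
  ...   | no x≢z   rewrite dec-false (x ≟ z) x≢z = find-remove Γ x≢y

  ∈-dom⁻ : ∀ {x} {Γ : Decls A} → x ∈ dom Γ → ∃[ a ] (x , a) ∈ Γ
  ∈-dom⁻ x∈ with (_ , a) , p , refl ← ∈-map⁻ proj₁ x∈ = a , p

  filter-∉∷ : ∀ x xs (Γ : Decls A) →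
    filter (λ d → ¬? (mem? _≟_ (proj₁ d) (x ∷ xs))) Γ ≡
    filter (λ d → ¬? (mem? _≟_ (proj₁ d) xs)) (remove x Γ)
  filter-∉∷ x xs [] = refl
  filter-∉∷ x xs ((y , a) ∷ Γ) with x ≟ y
  ... | yes refl rewrite dec-true (x ≟ x) refl = filter-∉∷ x xs Γ
  ... | no x≢y rewrite dec-false (x ≟ y) x≢y | dec-false (y ≟ x) (x≢y ∘ sym)
    with does (mem? _≟_ y xs)
  ...   | true  = filter-∉∷ x xs Γ
  ...   | false = cong (_ ∷_) (filter-∉∷ x xs Γ)

  remove-↭ : ∀ {x a} {Γ : Decls A} → Consistent Γ → (x , a) ∈ Γ → Γ ↭ (x , a) ∷ remove x Γ
  remove-↭ {x} {Γ = _ ∷ Γ} c (here refl)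
    rewrite dec-true (x ≟ x) refl | remove-∉ Γ (Unique[x∷xs]⇒x∉xs c) = ↭-refl
  remove-↭ {x} {Γ = (y , b) ∷ Γ} c@(_ ∷ c′) (there p)
    rewrite dec-false (x ≟ y) (λ { refl → Unique[x∷xs]⇒x∉xs c (∈-map⁺ proj₁ p) }) =
    ↭-trans (↭.prep _ (remove-↭ c′ p)) (↭.swap _ _ ↭-refl)

flat : {A : Set} → (A → List L₀) → Decls A → FlatEnv
flat f []            = []
flat f ((x , a) ∷ Γ) = List.map (x ,_) (f a) ++ flat f Γ

module _ {A : Set} (f : A → List L₀) where

  flat-↭ : ∀ {Γ Γ′} → Γ ↭ Γ′ → flat f Γ ↭ flat f Γ′
  flat-↭ ↭.refl = ↭-refl
  flat-↭ (↭.prep (x , a) p) = ↭.++⁺ˡ (List.map (x ,_) (f a)) (flat-↭ p)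
  flat-↭ (↭.swap (x , a) (y , b) p) =
    ↭-trans (↭.shifts (List.map (x ,_) (f a)) (List.map (y ,_) (f b)))
            (↭.++⁺ˡ (List.map (y ,_) (f b)) (↭.++⁺ˡ (List.map (x ,_) (f a)) (flat-↭ p)))
  flat-↭ (↭.trans p q) = ↭-trans (flat-↭ p) (flat-↭ q)

  flat-++ : ∀ Γ Γ′ → flat f (Γ ++ Γ′) ≡ flat f Γ ++ flat f Γ′
  flat-++ []            Γ′ = refl
  flat-++ ((x , a) ∷ Γ) Γ′ =
    trans (cong (List.map (x ,_) (f a) ++_) (flat-++ Γ Γ′))
          (sym (++-assoc (List.map (x ,_) (f a)) _ _))

  dom-flat : ∀ {x} Γ → x ∈ dom (flat f Γ) → x ∈ dom Γ
  dom-flat ((y , a) ∷ Γ) p with ∈-map⁻ proj₁ p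
  ... | _ , q , refl with ∈-++⁻ (List.map (y ,_) (f a)) q
  ...   | inj₁ r with _ , _ , refl ← ∈-map⁻ (y ,_) r = here refl
  ...   | inj₂ r = there (dom-flat Γ (∈-map⁺ proj₁ r))

  flat-remove : ∀ {x a Γ} → Consistent Γ → (x , a) ∈ Γ →
    flat f Γ ↭ List.map (x ,_) (f a) ++ flat f (remove x Γ)
  flat-remove c p = flat-↭ (remove-↭ c p)

flat* : {A : Set} → (A → List L₀) → ∀ {n} → Vec (Decls A) n → FlatEnv
flat* f []       = []
flat* f (Γ ∷ Γs) = flat f Γ ++ flat* f Γs

-- Intersection of environments as union of multisets

module Merge {A : Set} (_∩_ : A → A → A) where

  infixl 6 _⊎ᴱ_

  _⊎ᴱ_ : Decls A → Decls A → Decls A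
  _⊎ᴱ_ = merge _∩_

  -- Supplies the recursion on the left argument that the definition of `merge` does not have: once
  -- `x` is matched it can be removed from `Γ₂`, because no later lookup asks for it.
  merge-∷ : ∀ {x a} Γ₁ Γ₂ → x ∉ dom Γ₁ →
    ((x , a) ∷ Γ₁) ⊎ᴱ Γ₂ ≡ (x , maybe (a ∩_) a (find x Γ₂)) ∷ (Γ₁ ⊎ᴱ remove x Γ₂)
  merge-∷ {x} Γ₁ Γ₂ x∉ = cong (_ ∷_) (cong₂ _++_
    (map-cong-local (All.tabulate λ {(y , b)} p → cong (λ m → y , maybe (b ∩_) b m)
      (sym (find-remove Γ₂ λ { refl → x∉ (∈-map⁺ proj₁ p) }))))
    (filter-∉∷ x (dom Γ₁) Γ₂))

  merge-consistent : ∀ Γ₁ {Γ₂} → Consistent Γ₁ → Consistent Γ₂ → Consistent (Γ₁ ⊎ᴱ Γ₂)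
  merge-consistent Γ₁ {Γ₂} c₁ c₂ =
    subst Unique (sym (trans (map-++ proj₁ (List.map _ Γ₁) new)
                             (cong (_++ dom new) (sym (map-∘ Γ₁)))))
      (Unique.++⁺ c₁ (filter-consistent new? c₂) disjoint)
    where
    new? = λ (d : ℕ × A) → ¬? (mem? _≟_ (proj₁ d) (dom Γ₁))
    new = filter new? Γ₂
    disjoint : Disjoint (dom Γ₁) (dom new)
    disjoint (p , q) with a , r ← ∈-dom⁻ q = proj₂ (∈-filter⁻ new? {xs = Γ₂} r) p

  merge*-consistent : ∀ {n} (Γs : Vec (Decls A) (suc n)) →
    (∀ i → Consistent (lookup Γs i)) → Consistent (Vec.foldr₁ _⊎ᴱ_ Γs)
  merge*-consistent (Γ ∷ [])      c = c zero
  merge*-consistent (Γ ∷ Γ′ ∷ Γs) c =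
    merge-consistent Γ (c zero) (merge*-consistent (Γ′ ∷ Γs) (c ∘ suc))

  module _ (f : A → List L₀) (f-∩ : ∀ a b → f (a ∩ b) ≡ f a ++ f b) where

    flat-find : ∀ x a {Γ} → Consistent Γ →
      List.map (x ,_) (f (maybe (a ∩_) a (find x Γ))) ++ flat f (remove x Γ) ↭
      List.map (x ,_) (f a) ++ flat f Γ
    flat-find x a {Γ} c with mem? _≟_ x (dom Γ)
    ... | no x∉ rewrite find-∉ Γ x∉ =
      ↭-reflexive (cong (λ Γ → List.map (x ,_) (f a) ++ flat f Γ) (remove-∉ Γ x∉))
    ... | yes x∈ with b , p ← ∈-dom⁻ x∈ rewrite find-∈ c p | f-∩ a b | map-++ (x ,_) (f a) (f b) =
      ↭-trans (↭.++-assoc (List.map (x ,_) (f a)) _ _)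
              (↭.++⁺ˡ (List.map (x ,_) (f a)) (↭-sym (flat-remove f c p)))

    -- Consistency keeps multiplicities right. If `Γ₂` repeated a key of `Γ₁`, `find` would see one
    -- copy while the filter drops all; if `Γ₁` repeated a key, the predicate from `Γ₂` would be
    -- counted twice.
    flat-merge : ∀ {Γ₁ Γ₂} → Consistent Γ₁ → Consistent Γ₂ →
      flat f (Γ₁ ⊎ᴱ Γ₂) ↭ flat f Γ₁ ++ flat f Γ₂
    flat-merge {[]} {Γ₂} c₁ c₂ =
      ↭-reflexive (cong (flat f)
        (filter-all (λ d → ¬? (mem? _≟_ (proj₁ d) [])) (All.universal (λ _ ()) Γ₂)))
    flat-merge {(x , a) ∷ Γ₁} {Γ₂} c@(_ ∷ c₁) c₂ = begin
      flat f (((x , a) ∷ Γ₁) ⊎ᴱ Γ₂)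
        ≡⟨ cong (flat f) (merge-∷ {a = a} Γ₁ Γ₂ (Unique[x∷xs]⇒x∉xs c)) ⟩
      A′ ++ flat f (Γ₁ ⊎ᴱ remove x Γ₂)
        ↭⟨ ↭.++⁺ˡ A′ (flat-merge c₁ (filter-consistent _ c₂)) ⟩
      A′ ++ flat f Γ₁ ++ flat f (remove x Γ₂)
        ↭⟨ ↭.shifts A′ (flat f Γ₁) ⟩
      flat f Γ₁ ++ A′ ++ flat f (remove x Γ₂)
        ↭⟨ ↭.++⁺ˡ (flat f Γ₁) (flat-find x a c₂) ⟩
      flat f Γ₁ ++ List.map (x ,_) (f a) ++ flat f Γ₂
        ↭⟨ ↭.shifts (flat f Γ₁) (List.map (x ,_) (f a)) ⟩
      List.map (x ,_) (f a) ++ flat f Γ₁ ++ flat f Γ₂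
        ↭⟨ ↭.++-assoc (List.map (x ,_) (f a)) (flat f Γ₁) _ ⟨
      (List.map (x ,_) (f a) ++ flat f Γ₁) ++ flat f Γ₂ ∎
      where
      open PermutationReasoning
      A′ = List.map (x ,_) (f (maybe (a ∩_) a (find x Γ₂)))

    flat-merge* : ∀ {n} (Γs : Vec (Decls A) (suc n)) →
      (∀ i → Consistent (lookup Γs i)) → flat f (Vec.foldr₁ _⊎ᴱ_ Γs) ↭ flat* f Γs
    flat-merge* (Γ ∷ [])      c = ↭-sym (↭.++-identityʳ (flat f Γ))
    flat-merge* (Γ ∷ Γ′ ∷ Γs) c =
      ↭-trans (flat-merge {Γ} (c zero) (merge*-consistent (Γ′ ∷ Γs) (c ∘ suc)))
              (↭.++⁺ˡ (flat f Γ) (flat-merge* (Γ′ ∷ Γs) (c ∘ suc)))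

-- Consistency of derivable judgments and translation of derivations

Unique-resp-↭ : ∀ {xs ys : List ℕ} → xs ↭ ys → Unique xs → Unique ys
Unique-resp-↭ = SetoidPermutation.Unique-resp-↭ (setoid ℕ) ∘ ↭⇒↭ₛ

Consistent-resp-↭ : ∀ {A : Set} {Γ Γ′ : Decls A} → Γ ↭ Γ′ → Consistent Γ → Consistent Γ′
Consistent-resp-↭ = Unique-resp-↭ ∘ ↭.map⁺ proj₁

Consistent-++ˡ : ∀ {A : Set} Γ {Γ′ : Decls A} → Consistent (Γ ++ Γ′) → Consistent Γ
Consistent-++ˡ []      c       = []
Consistent-++ˡ (d ∷ Γ) (x∉ ∷ c) = All.map⁺ (All.++⁻ˡ Γ (All.map⁻ x∉)) ∷ Consistent-++ˡ Γ c

∉-dom-∷ʳ : ∀ {A : Set} {x} {a : A} Γ → Consistent (Γ ∷ʳ (x , a)) → x ∉ dom Γ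
∉-dom-∷ʳ {x = x} {a} Γ c = Unique[x∷xs]⇒x∉xs (Consistent-resp-↭ (↭-sym (↭.∷↭∷ʳ (x , a) Γ)) c)

⊢-consistent : ∀ {Γ b M σ} → Γ ⊢[ b ] M ∶ σ → Consistent Γ
⊢-consistent (conv D Γ≈ _ _) = subst Unique (go Γ≈) (⊢-consistent D)
  where
  go : ∀ {Γ Γ′} → Γ ≈ᴱ Γ′ → dom Γ ≡ dom Γ′
  go []               = refl
  go ((refl , _) ∷ p) = cong (_ ∷_) (go p)
⊢-consistent axiom = [] ∷ []
⊢-consistent (exchange {Γ₁} D) = Consistent-resp-↭ (↭.++⁺ˡ Γ₁ (↭.swap _ _ ↭-refl)) (⊢-consistent D)
⊢-consistent (contraction _ c) = c
⊢-consistent (⊸-intro D)       = Consistent-++ˡ _ (⊢-consistent D)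
⊢-consistent (⊸-introₜ D)      = Consistent-++ˡ _ (⊢-consistent D)
⊢-consistent (⇒-intro D)       = Consistent-++ˡ _ (⊢-consistent D)
⊢-consistent (⇒-introₜ D _)    = Consistent-++ˡ _ (⊢-consistent D)
⊢-consistent (⊸-elim _ _ c)    = c
⊢-consistent (⊸-elimₜ _ _ c)   = c
⊢-consistent (⇒-elim _ _ c)    = c
⊢-consistent (⇒-elimₜ _ _ c)   = c

types : L₁ × Q₁ → List L₀
types = toList ∘ proj₁

toList-⁺++⁺ : ∀ {A : Set} (xs ys : List⁺ A) → toList (xs ⁺++⁺ ys) ≡ toList xs ++ toList ys
toList-⁺++⁺ (_ ∷ _) (_ ∷ _) = refl

toList-fromVec : ∀ {A : Set} {n} (xs : Vec A (suc n)) → toList (fromVec xs) ≡ Vec.toList xs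
toList-fromVec (_ ∷ _) = refl

flat-≈ᴱ : ∀ {Γ Γ′} → Γ ≈ᴱ Γ′ → flat types Γ ↭ flat types Γ′
flat-≈ᴱ []                       = ↭-refl
flat-≈ᴱ ((refl , τ⃗≈ , _) ∷ Γ≈) = ↭.++⁺ (↭.map⁺ _ τ⃗≈) (flat-≈ᴱ Γ≈)

flat-∷ʳ : ∀ {A : Set} (f : A → List L₀) Γ {x a} →
  flat f (Γ ∷ʳ (x , a)) ≡ flat f Γ ++ List.map (x ,_) (f a)
flat-∷ʳ f Γ = trans (flat-++ f Γ _) (cong (flat f Γ ++_) (++-identityʳ _))

≈₂-refl : ∀ {σ} → σ ≈₂ σ
≈₂-refl {tv _}   = tv
≈₂-refl {_ ⊸ _}  = _ ⊸ ≈₂-refl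
≈₂-refl {_ ⇒ _}  = ↭-refl ⇒ ≈₂-refl

-- The two substitutions compose to one renaming that sends `x₁` and `x₂` to `x` and fixes `Δ`.
-- Since `x` may coincide with `x₁` or `x₂`, `ρ₂-fix` checks that the second substitution does not
-- undo the first.
⊩-contract : ∀ {Δ M σ x₁ x₂} x {τs₁ τs₂} → x₁ ∉ dom Δ → x₂ ∉ dom Δ →
  List.map (x₁ ,_) τs₁ ++ List.map (x₂ ,_) τs₂ ++ Δ ⊩ M ∶ σ →
  List.map (x ,_) (τs₁ ++ τs₂) ++ Δ ⊩ (M [ x / x₁ ]) [ x / x₂ ] ∶ σ
⊩-contract {Δ} {M} {σ} {x₁} {x₂} x {τs₁} {τs₂} x₁∉ x₂∉ D =
  subst₂ (_⊩_∶ σ) env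
    (trans (sym ([/]≡rename (rename ρ₁ M))) (cong (_[ x / x₂ ]) (sym ([/]≡rename M))))
    (⊩-rename ρ₂ (⊩-rename ρ₁ D))
  where
  ρ₁ = id [ x₁ ≔ᵛ x ]
  ρ₂ = id [ x₂ ≔ᵛ x ]
  ρ = ρ₂ ∘ ρ₁
  ρ₂-fix : ρ₂ x ≡ x
  ρ₂-fix with x ≟ x₂
  ... | yes refl = ≔ᵛ-≡ id x x
  ... | no x≢x₂  = ≔ᵛ-≢ id x x≢x₂
  ρ-x₁ : ρ x₁ ≡ x
  ρ-x₁ = trans (cong ρ₂ (≔ᵛ-≡ id x₁ x)) ρ₂-fix
  ρ-x₂ : ρ x₂ ≡ x
  ρ-x₂ with x₂ ≟ x₁
  ... | yes refl = ρ-x₁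
  ... | no x₂≢x₁ = trans (cong ρ₂ (≔ᵛ-≢ id x x₂≢x₁)) (≔ᵛ-≡ id x₂ x)
  ρ-Δ : ∀ {z} → z ∈ dom Δ → ρ z ≡ z
  ρ-Δ {z} z∈ = trans (cong ρ₂ (≔ᵛ-≢ id {x₁} {z} x λ { refl → x₁∉ z∈ }))
                     (≔ᵛ-≢ id x λ { refl → x₂∉ z∈ })
  bind : ∀ {z} → ρ z ≡ x → ∀ τs → renameᴱ ρ (List.map (z ,_) τs) ≡ List.map (x ,_) τs
  bind ρz τs = trans (sym (map-∘ τs)) (map-cong (λ τ → cong (_, τ) ρz) τs)
  env : renameᴱ ρ₂ (renameᴱ ρ₁ (List.map (x₁ ,_) τs₁ ++ List.map (x₂ ,_) τs₂ ++ Δ)) ≡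
        List.map (x ,_) (τs₁ ++ τs₂) ++ Δ
  env = begin
    renameᴱ ρ₂ (renameᴱ ρ₁ (List.map (x₁ ,_) τs₁ ++ List.map (x₂ ,_) τs₂ ++ Δ))
      ≡⟨ map-∘ _ ⟨
    renameᴱ ρ (List.map (x₁ ,_) τs₁ ++ List.map (x₂ ,_) τs₂ ++ Δ)
      ≡⟨ map-++ _ (List.map (x₁ ,_) τs₁) _ ⟩
    renameᴱ ρ (List.map (x₁ ,_) τs₁) ++ renameᴱ ρ (List.map (x₂ ,_) τs₂ ++ Δ)
      ≡⟨ cong₂ _++_ (bind ρ-x₁ τs₁) (trans (map-++ _ (List.map (x₂ ,_) τs₂) Δ)
           (cong₂ _++_ (bind ρ-x₂ τs₂)
             (map-id-local (All.tabulate λ {d} p → cong (_, proj₂ d) (ρ-Δ (∈-map⁺ proj₁ p)))))) ⟩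
    List.map (x ,_) τs₁ ++ List.map (x ,_) τs₂ ++ Δ
      ≡⟨ ++-assoc (List.map (x ,_) τs₁) _ _ ⟨
    (List.map (x ,_) τs₁ ++ List.map (x ,_) τs₂) ++ Δ
      ≡⟨ cong (_++ Δ) (map-++ _ τs₁ τs₂) ⟨
    List.map (x ,_) (τs₁ ++ τs₂) ++ Δ ∎
    where open ≡-Reasoning

⊩*-tabulate : ∀ {n M} (Γs : Vec Env n) (τs : Vec L₀ n) →
  (∀ i → flat types (lookup Γs i) ⊩ M ∶ ⌈ lookup τs i ⌉) → flat* types Γs ⊩* M ∶ Vec.toList τs
⊩*-tabulate []       []       D = []
⊩*-tabulate (Γ ∷ Γs) (τ ∷ τs) D = D zero ∷ ⊩*-tabulate Γs τs (D ∘ suc)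

⊢⇒⊩ : ∀ {Γ b M σ s} → Γ ⊢[ b ] M ∶ (σ , s) → flat types Γ ⊩ M ∶ σ

⊢⇒⊩-abs : ∀ {n Γ x t⃗ b M σ s} {τs : Vec L₀ (2 + n)} →
  Γ ∷ʳ (x , fromVec τs , t⃗) ⊢[ b ] M ∶ (σ , s) → flat types Γ ⊩ ƛ x M ∶ τs ⇒ σ

⊢⇒⊩-app : ∀ {n Γ} {Γs : Vec Env (2 + n)} {b} {bs : Vec ℕ (2 + n)} {M₁ M₂ σ s}
            {τs : Vec L₀ (2 + n)} {ss : Fin (2 + n) → Q₂} →
  Γ ⊢[ b ] M₁ ∶ (τs ⇒ σ , s) →
  (∀ i → lookup Γs i ⊢[ lookup bs i ] M₂ ∶ (⌈ lookup τs i ⌉ , ss i)) →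
  flat types (Γ ++ ⨁ Γs) ⊩ M₁ · M₂ ∶ σ

⊢⇒⊩ (conv D Γ≈ σ≈ _) = conv (⊢⇒⊩ D) (flat-≈ᴱ Γ≈) σ≈
⊢⇒⊩ axiom = var
⊢⇒⊩ (exchange {Γ₁} D) = conv (⊢⇒⊩ D) (flat-↭ types (↭.++⁺ˡ Γ₁ (↭.swap _ _ ↭-refl))) ≈₂-refl
⊢⇒⊩ (contraction {Γ₁} {Γ₂} {x₁} {x₂} {x} {τ⃗₁} {τ⃗₂} {t⃗₁} {t⃗₂} D _) =
  conv (⊩-contract x {toList τ⃗₁} {toList τ⃗₂}
         (λ p → Unique[x∷xs]⇒x∉xs c (there (dom-flat types (Γ₁ ++ Γ₂) p)))
         (λ p → Unique[x∷xs]⇒x∉xs (tailᶜ c) (dom-flat types (Γ₁ ++ Γ₂) p))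
         (conv (⊢⇒⊩ D) (flat-↭ types moved) ≈₂-refl))
    (↭-trans (↭-reflexive (cong (λ τs → List.map (x ,_) τs ++ flat types (Γ₁ ++ Γ₂))
                                (sym (toList-⁺++⁺ τ⃗₁ τ⃗₂))))
             (flat-↭ types (↭-sym (↭.shift (x , τ⃗₁ ⁺++⁺ τ⃗₂ , t⃗₁ ⁺++⁺ t⃗₂) Γ₁ Γ₂))))
    ≈₂-refl
  where
  d₁ = x₁ , τ⃗₁ , t⃗₁
  d₂ = x₂ , τ⃗₂ , t⃗₂
  moved : Γ₁ ++ d₁ ∷ d₂ ∷ Γ₂ ↭ d₁ ∷ d₂ ∷ Γ₁ ++ Γ₂
  moved = ↭-trans (↭.shift d₁ Γ₁ (d₂ ∷ Γ₂)) (↭.prep d₁ (↭.shift d₂ Γ₁ Γ₂))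
  c : Consistent (d₁ ∷ d₂ ∷ Γ₁ ++ Γ₂)
  c = Consistent-resp-↭ moved (⊢-consistent D)
  tailᶜ : ∀ {x xs} → Unique (x ∷ xs) → Unique xs
  tailᶜ (_ ∷ u) = u
⊢⇒⊩ (⊸-intro {Γ} D) = abs-⊸ (subst (_⊩ _ ∶ _) (flat-∷ʳ types Γ) (⊢⇒⊩ D))
  (∉-dom-∷ʳ Γ (⊢-consistent D) ∘ dom-flat types Γ)
⊢⇒⊩ (⊸-introₜ {Γ} D) = abs-⊸ (subst (_⊩ _ ∶ _) (flat-∷ʳ types Γ) (⊢⇒⊩ D))
  (∉-dom-∷ʳ Γ (⊢-consistent D) ∘ dom-flat types Γ)
⊢⇒⊩ (⇒-intro D)    = ⊢⇒⊩-abs D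
⊢⇒⊩ (⇒-introₜ D _) = ⊢⇒⊩-abs D
⊢⇒⊩ (⊸-elim {Γ₁} {Γ₂} D E _) = subst (_⊩ _ ∶ _) (sym (flat-++ types Γ₁ Γ₂)) (app-⊸ (⊢⇒⊩ D) (⊢⇒⊩ E))
⊢⇒⊩ (⊸-elimₜ {Γ₁} {Γ₂} D E _) = subst (_⊩ _ ∶ _) (sym (flat-++ types Γ₁ Γ₂)) (app-⊸ (⊢⇒⊩ D) (⊢⇒⊩ E))
⊢⇒⊩ (⇒-elim {Γs = Γs} {bs = bs} D Es _)  = ⊢⇒⊩-app {Γs = Γs} {bs = bs} D Es
⊢⇒⊩ (⇒-elimₜ {Γs = Γs} {bs = bs} D Es _) = ⊢⇒⊩-app {Γs = Γs} {bs = bs} D Es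

⊢⇒⊩-abs {Γ = Γ} {x} {τs = τs} D =
  abs-⇒ (subst (_⊩ _ ∶ _)
          (trans (flat-∷ʳ types Γ)
                 (cong (λ τs → flat types Γ ++ List.map (x ,_) τs) (toList-fromVec τs)))
          (⊢⇒⊩ D))
    (∉-dom-∷ʳ Γ (⊢-consistent D) ∘ dom-flat types Γ)

⊢⇒⊩-app {Γ = Γ} {Γs} {τs = τs} D Es =
  conv (app-⇒ (⊢⇒⊩ D) (⊩*-tabulate Γs τs (λ i → ⊢⇒⊩ (Es i))))
    (↭-trans (↭.++⁺ˡ (flat types Γ) (↭-sym
                (Merge.flat-merge* _ types (λ (τ⃗ , _) (τ⃗′ , _) → toList-⁺++⁺ τ⃗ τ⃗′) Γs
                  (λ i → ⊢-consistent (Es i)))))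
             (↭-reflexive (sym (flat-++ types Γ (⨁ Γs)))))
    ≈₂-refl

-- Unification

infix 4 _over_

-- Tracks that a type mentions only used variables, so that assigning values to new ones leaves its
-- instance unchanged.
data _over_ : L₀ → List TVar → Set where
  tv  : ∀ {V α} → α ∈ V → tv α over V
  _⊸_ : ∀ {V τ τ′} → τ over V → τ′ over V → (τ ⊸ τ′) over V

_≟₀_ : DecidableEquality L₀
tv α ≟₀ tv β = map′ (cong tv) (λ { refl → refl }) (α ≟ β)
tv α ≟₀ (τ ⊸ τ′) = no λ ()
(τ ⊸ τ′) ≟₀ tv α = no λ ()
(τ₁ ⊸ τ₂) ≟₀ (τ₃ ⊸ τ₄) =
  map′ (λ (p , q) → cong₂ _⊸_ p q) (λ { refl → refl , refl }) (τ₁ ≟₀ τ₃ ×-dec τ₂ ≟₀ τ₄)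

_≟ₑ_ : DecidableEquality Equation
(τ₁ ≐ τ₂) ≟ₑ (τ₃ ≐ τ₄) =
  map′ (λ (p , q) → cong₂ _≐_ p q) (λ { refl → refl , refl }) (τ₁ ≟₀ τ₃ ×-dec τ₂ ≟₀ τ₄)

_occursIn?_ : ∀ α τ → Dec (α occursIn τ)
α occursIn? tv β = map′ (λ { refl → here }) (λ { here → refl }) (α ≟ β)
α occursIn? (τ ⊸ τ′) =
  map′ [ left , right ]′ (λ { (left o) → inj₁ o ; (right o) → inj₂ o })
    (α occursIn? τ ⊎-dec α occursIn? τ′)

_occursInEq?_ : ∀ α e → Dec (α occursInEq e)
α occursInEq? (τ ≐ τ′) = α occursIn? τ ⊎-dec α occursIn? τ′

infix 25 _[_≔_]

_[_≔_] : L₀ → TVar → L₀ → L₀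
τ′ [ α ≔ τ ] = apply ((α , τ) ∷ []) τ′

≔-≢ : ∀ {α β} τ → β ≢ α → tv β [ α ≔ τ ] ≡ tv β
≔-≢ {α} {β} τ β≢α rewrite dec-false (β ≟ α) β≢α = refl

≔-≡ : ∀ α τ → tv α [ α ≔ τ ] ≡ τ
≔-≡ α τ rewrite dec-true (α ≟ α) refl = refl

≔-unused : ∀ {α τ} τ′ → ¬ (α occursIn τ′) → τ′ [ α ≔ τ ] ≡ τ′
≔-unused (tv β)      α∉ = ≔-≢ _ λ { refl → α∉ here }
≔-unused (τ₁ ⊸ τ₂) α∉ = cong₂ _⊸_ (≔-unused τ₁ (α∉ ∘ left)) (≔-unused τ₂ (α∉ ∘ right))

≔-unusedEq : ∀ {α τ} e → ¬ (α occursInEq e) → applyEq ((α , τ) ∷ []) e ≡ e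
≔-unusedEq (τ₁ ≐ τ₂) α∉ = cong₂ _≐_ (≔-unused τ₁ (α∉ ∘ inj₁)) (≔-unused τ₂ (α∉ ∘ inj₂))

≔-occurs : ∀ {α β τ} τ′ → β occursIn τ′ [ α ≔ τ ] → β occursIn τ′ × β ≢ α ⊎ β occursIn τ
≔-occurs {α} {β} {τ} (tv γ) o with γ ≟ α
... | yes refl = inj₂ (subst (β occursIn_) (≔-≡ α τ) o)
... | no γ≢α with here ← subst (β occursIn_) (≔-≢ τ γ≢α) o = inj₁ (here , γ≢α)
≔-occurs (τ₁ ⊸ τ₂) (left o)  with ≔-occurs τ₁ o
... | inj₁ (o′ , β≢α) = inj₁ (left o′ , β≢α)
... | inj₂ o′         = inj₂ o′
≔-occurs (τ₁ ⊸ τ₂) (right o) with ≔-occurs τ₂ o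
... | inj₁ (o′ , β≢α) = inj₁ (right o′ , β≢α)
... | inj₂ o′         = inj₂ o′

≔-over : ∀ {V α τ τ′} → τ over V → τ′ over V → τ′ [ α ≔ τ ] over V
≔-over {V} {α} {τ} p (tv {α = β} β∈V) with β ≟ α
... | yes refl = subst (_over V) (sym (≔-≡ α τ)) p
... | no β≢α   = subst (_over V) (sym (≔-≢ τ β≢α)) (tv β∈V)
≔-over p (q ⊸ q′) = ≔-over p q ⊸ ≔-over p q′

size : L₀ → ℕ
size (tv _)   = 1
size (τ ⊸ τ′) = suc (size τ + size τ′)

0<size : ∀ τ → 0 < size τ
0<size (tv _)  = s≤s z≤n
0<size (_ ⊸ _) = s≤s z≤n

occurs-size : ∀ θ {α τ} → α occursIn τ → size (θ ⟨ tv α ⟩₀) ≤ size (θ ⟨ τ ⟩₀)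
occurs-size θ here      = ℕ.≤-refl
occurs-size θ (left o)  = ℕ.m≤n⇒m≤1+n (ℕ.≤-trans (occurs-size θ o) (ℕ.m≤m+n _ _))
occurs-size θ (right o) = ℕ.m≤n⇒m≤1+n (ℕ.≤-trans (occurs-size θ o) (ℕ.m≤n+m _ _))

-- If `α` occurred properly in `τ`, the instance of `τ` would be strictly larger than that of `α`.
-- Hence an equation with a unifier never triggers the occurs check.
not-cyclic : ∀ θ {α τ} → θ ⟨ tv α ⟩₀ ≡ θ ⟨ τ ⟩₀ → tv α ≢ τ → ¬ (α occursIn τ)
not-cyclic θ eq α≢τ here      = α≢τ refl
not-cyclic θ eq α≢τ (left o)  =
  ℕ.<-irrefl (cong size eq) (s≤s (ℕ.≤-trans (occurs-size θ o) (ℕ.m≤m+n _ _)))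
not-cyclic θ eq α≢τ (right o) =
  ℕ.<-irrefl (cong size eq) (s≤s (ℕ.≤-trans (occurs-size θ o) (ℕ.m≤n+m _ _)))

⊸-injective : ∀ {τ₁ τ₂ τ₃ τ₄ : L₀} → _≡_ {A = L₀} (τ₁ ⊸ τ₂) (τ₃ ⊸ τ₄) → τ₁ ≡ τ₃ × τ₂ ≡ τ₄
⊸-injective refl = refl , refl

equations : Decls L₀ → Problem
equations = List.map λ (α , τ) → tv α ≐ τ

infix 4 _∈ₑ?_

_∈ₑ?_ : (e : Equation) (P : Problem) → Dec (e ∈ P)
_∈ₑ?_ = mem? _≟ₑ_

module SetEq = Setoid ([ set ]-Equality Equation)

∷-duplicate : ∀ {e : Equation} {P} → e ∈ P → e ∷ P ∼[ set ] P
∷-duplicate e∈P = mk⇔ (λ { (here refl) → e∈P ; (there p) → p }) there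

∷-shift : ∀ {e : Equation} P {Q} → P ++ e ∷ Q ∼[ set ] e ∷ P ++ Q
∷-shift P {Q} = bag-=⇒ (↭⇒∼bag (↭.shift _ P Q))

-- Running UNIFY_Q against a known unifier θ makes termination easy: the total
-- size of the θ-instances of the left-hand sides of the pending equations is
-- unchanged by an elimination, so it decreases at every step that solves or
-- decomposes an equation.
module Unification (θ : Subst) (V : List TVar) where

  Good : Equation → Set
  Good (τ ≐ τ′) = θ ⟨ τ ⟩₀ ≡ θ ⟨ τ′ ⟩₀ × τ over V × τ′ over V

  weight : Problem → ℕ
  weight []            = 0
  weight ((τ ≐ _) ∷ P) = size (θ ⟨ τ ⟩₀) + weight P

  -- B is the solved part of a problem, and P is the rest.
  record Invariant (B : Decls L₀) (P : Problem) : Set where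
    constructor invariant
    field
      unique  : Unique (dom B)
      solved  : All (λ (α , _) → All (λ (_ , τ) → ¬ (α occursIn τ)) B) B
      unused  : All (λ (α , _) → All (λ e → ¬ (α occursInEq e)) P) B
      good    : All Good (equations B)
      pending : All Good P

  Result : Problem → Set
  Result P = ∃[ S ] ∃[ b ] UNIFYQ P S b × All Good (equations (bindings S))

  after : ∀ {P Q b} → P ⟹[ b ] ⟨ Q ⟩ → Result Q → Result P
  after s (S , b , (R , run , sol) , g) = S , _ , (R , step s run , sol) , g

  ≔-unifier : ∀ {α τ} τ′ → θ ⟨ tv α ⟩₀ ≡ θ ⟨ τ ⟩₀ → θ ⟨ τ′ [ α ≔ τ ] ⟩₀ ≡ θ ⟨ τ′ ⟩₀
  ≔-unifier {α} {τ} (tv β) eq with β ≟ α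
  ... | yes refl = trans (cong (θ ⟨_⟩₀) (≔-≡ α τ)) (sym eq)
  ... | no β≢α   = cong (θ ⟨_⟩₀) (≔-≢ τ β≢α)
  ≔-unifier (τ₁ ⊸ τ₂) eq = cong₂ _⊸_ (≔-unifier τ₁ eq) (≔-unifier τ₂ eq)

  ≔-good : ∀ {α τ} → Good (tv α ≐ τ) → ∀ {e} → Good e → Good (applyEq ((α , τ) ∷ []) e)
  ≔-good (eq , _ , τ/V) {τ₁ ≐ τ₂} (eq′ , p , q) =
    trans (≔-unifier τ₁ eq) (trans eq′ (sym (≔-unifier τ₂ eq))) , ≔-over τ/V p , ≔-over τ/V q

  ≔-weight : ∀ {α τ} → Good (tv α ≐ τ) → ∀ P →
    weight (List.map (applyEq ((α , τ) ∷ [])) P) ≡ weight P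
  ≔-weight g []            = refl
  ≔-weight g ((τ₁ ≐ τ₂) ∷ P) = cong₂ _+_ (cong size (≔-unifier τ₁ (proj₁ g))) (≔-weight g P)

  drop : ∀ {B e P} → Invariant B (e ∷ P) → Invariant B P
  drop (invariant u s f g (_ ∷ p)) = invariant u s (All.map All.tail f) g p

  swapped : ∀ {B τ τ′ P} → Invariant B ((τ ≐ τ′) ∷ P) → Invariant B ((τ′ ≐ τ) ∷ P)
  swapped (invariant u s f g ((eq , o , o′) ∷ p)) =
    invariant u s (All.map (λ { (n ∷ ns) → n ∘ [ inj₂ , inj₁ ]′ ∷ ns }) f) g ((sym eq , o′ , o) ∷ p)

  decomposed : ∀ {B τ₁ τ₂ τ₃ τ₄ P} → Invariant B ((τ₁ ⊸ τ₂ ≐ τ₃ ⊸ τ₄) ∷ P) →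
    Invariant B ((τ₁ ≐ τ₃) ∷ (τ₂ ≐ τ₄) ∷ P)
  decomposed (invariant u s f g ((eq , o₁ ⊸ o₂ , o₃ ⊸ o₄) ∷ p)) =
    invariant u s
      (All.map (λ { (n ∷ ns) → n ∘ [ inj₁ ∘ left , inj₂ ∘ left ]′
                             ∷ n ∘ [ inj₁ ∘ right , inj₂ ∘ right ]′
                             ∷ ns }) f)
      g
      ((proj₁ (⊸-injective eq) , o₁ , o₃) ∷ (proj₂ (⊸-injective eq) , o₂ , o₄) ∷ p)

  module _ {α : TVar} {τ : L₀} {B : Decls L₀} {P : Problem}
    (inv : Invariant B ((tv α ≐ τ) ∷ P)) (acyclic : ¬ (α occursIn τ)) where

    open Invariant inv

    B′ : Decls L₀
    B′ = List.map (map₂ _[ α ≔ τ ]) B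

    P′ : Problem
    P′ = List.map (applyEq ((α , τ) ∷ [])) P

    ∉B : All (λ (β , _) → β ≢ α) B
    ∉B = All.map (λ { (n ∷ _) refl → n (inj₁ here) }) unused

    ∉τ : All (λ (β , _) → ¬ (β occursIn τ)) B
    ∉τ = All.map (λ { (n ∷ _) o → n (inj₂ o) }) unused

    equations-eliminated : equations B′ ++ P′ ≡ List.map (applyEq ((α , τ) ∷ [])) (equations B ++ P)
    equations-eliminated = sym (trans (map-++ _ (equations B) P) (cong (_++ P′) (go ∉B)))
      where
      go : ∀ {B} → All (λ (β , _) → β ≢ α) B →
           List.map (applyEq ((α , τ) ∷ [])) (equations B) ≡
           equations (List.map (map₂ _[ α ≔ τ ]) B)
      go []             = refl
      go {(_ , τ′) ∷ _} (β≢α ∷ rest) = cong₂ _∷_ (cong (_≐ τ′ [ α ≔ τ ]) (≔-≢ τ β≢α)) (go rest)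

    eliminated : Invariant ((α , τ) ∷ B′) P′
    eliminated = record
      { unique  = subst Unique (cong (α ∷_) (map-∘ B))
                    (All.map⁺ (All.map (λ β≢α → β≢α ∘ sym) ∉B) ∷ unique)
      ; solved  = (acyclic ∷ All.map⁺ (All.universal (λ (_ , τ′) → α-gone τ′) B))
                ∷ All.map⁺ (All.zipWith (λ (∉τ , s) →
                    ∉τ ∷ All.map⁺ (All.map (λ {d} → β-gone (proj₂ d) ∉τ) s)) (∉τ , solved))
      ; unused  = All.map⁺ (All.universal (λ { (τ₁ ≐ τ₂) → [ α-gone τ₁ , α-gone τ₂ ]′ }) P)
                ∷ All.map⁺ (All.zipWith (λ { (∉τ , _ ∷ ns) →
                    All.map⁺ (All.map (λ { {τ₁ ≐ τ₂} n →
                      [ β-gone τ₁ ∉τ (n ∘ inj₁) , β-gone τ₂ ∉τ (n ∘ inj₂) ]′ }) ns) })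
                    (∉τ , unused))
      ; good    = All.head pending
                ∷ All.map⁺ (All.map⁺ (All.map (λ { {β , τ′} (g , β≢α) →
                    subst (λ τ″ → Good (τ″ ≐ τ′ [ α ≔ τ ])) (≔-≢ τ β≢α)
                      (≔-good (All.head pending) g) })
                    (All.zip (All.map⁻ good , ∉B))))
      ; pending = All.map⁺ (All.map (≔-good (All.head pending)) (All.tail pending))
      }
      where
      α-gone : ∀ τ′ → ¬ (α occursIn τ′ [ α ≔ τ ])
      α-gone τ′ o with ≔-occurs τ′ o
      ... | inj₁ (_ , α≢α) = α≢α refl
      ... | inj₂ o′        = acyclic o′
      β-gone : ∀ {β} τ′ → ¬ (β occursIn τ) → ¬ (β occursIn τ′) → ¬ (β occursIn τ′ [ α ≔ τ ])
      β-gone τ′ β∉τ β∉τ′ o with ≔-occurs τ′ o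
      ... | inj₁ (o′ , _) = β∉τ′ o′
      ... | inj₂ o′       = β∉τ o′

  private
    lighter : ∀ {τ n P} → weight ((τ ≐ τ) ∷ P) < suc n → weight P < n
    lighter {τ} (s≤s w) = ℕ.<-≤-trans (ℕ.+-monoˡ-≤ _ (0<size (θ ⟨ τ ⟩₀))) w

  -- `n` is the fuel. `P₀` is any list for the same set, so reordering equations or discarding a
  -- duplicate costs no unification step. In `solve` the leading equation is about to leave the
  -- pending ones, so only the weight of the others is bounded.
  unify : ∀ n {B P P₀} → Invariant B P → weight P < n → P₀ ∼[ set ] equations B ++ P → Result P₀
  solve : ∀ n {B α τ P P₀} → Invariant B ((tv α ≐ τ) ∷ P) → weight P < n → tv α ≢ τ →
    P₀ ∼[ set ] (tv α ≐ τ) ∷ equations B ++ P → Result P₀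

  unify (suc n) {B} {[]} (invariant u s _ g _) _ P₀∼ =
    ⟪ B , u ⟫ , 0 , (_ , done , subst (_ ∼[ set ]_) (++-identityʳ (equations B)) P₀∼ , s) , g
  unify (suc n) {B} {(τ ≐ τ′) ∷ P} inv w P₀∼ with (τ ≐ τ′) ∈ₑ? (equations B ++ P)
  -- As a set, the problem already lacks this second copy; the rules apply only to an equation
  -- absent from the remainder.
  ... | yes dup = unify n (drop inv) (lighter {τ} {P = P} w)
                    (SetEq.trans P₀∼ (SetEq.trans (∷-shift (equations B)) (∷-duplicate dup)))
  ... | no new with τ ≟₀ τ′
  ... | yes refl = after (delete (SetEq.trans P₀∼ (∷-shift (equations B)) , new))
                     (unify n (drop inv) (lighter {τ} {P = P} w) SetEq.refl)
  unify (suc n) {B} {(tv α ≐ τ′) ∷ P} inv w P₀∼ | no new | no α≢τ′ =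
    solve n inv (lighter {tv α} {P = P} w) α≢τ′ (SetEq.trans P₀∼ (∷-shift (equations B)))
  unify (suc n) {B} {(τ@(_ ⊸ _) ≐ tv α) ∷ P} inv w P₀∼ | no new | no _ =
    after (orient (SetEq.trans P₀∼ (∷-shift (equations B)) , new))
      (solve n (swapped inv) (lighter {τ} {P = P} w) (λ ()) SetEq.refl)
  unify (suc n) {B} {(τ₁ ⊸ τ₂ ≐ τ₃ ⊸ τ₄) ∷ P} inv (s≤s w) P₀∼ | no new | no _ =
    after (decompose (SetEq.trans P₀∼ (∷-shift (equations B)) , new))
      (unify n (decomposed inv)
        -- The weight drops by the one unit that `size` counts for the arrow.
        (subst (_< n) (ℕ.+-assoc (size (θ ⟨ τ₁ ⟩₀)) _ _) w)
        (SetEq.sym (SetEq.trans (∷-shift (equations B)) (∷-cong refl (∷-shift (equations B))))))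

  solve n {B} {α} {τ} {P} inv w α≢τ P₀∼ with (tv α ≐ τ) ∈ₑ? (equations B ++ P)
  -- Orienting an equation can produce one that is already present.
  ... | yes dup = unify n (drop inv) w (SetEq.trans P₀∼ (∷-duplicate dup))
  ... | no new = continue (any? (α occursInEq?_) (equations B ++ P))
    where
    acyclic : ¬ (α occursIn τ)
    acyclic = not-cyclic θ (proj₁ (All.head (Invariant.pending inv))) α≢τ
    next : ∀ {Q} →
      Q ∼[ set ] (tv α ≐ τ) ∷ List.map (applyEq ((α , τ) ∷ [])) (equations B ++ P) → Result Q
    next Q∼ = unify n (eliminated inv acyclic)
                (subst (_< n) (sym (≔-weight (All.head (Invariant.pending inv)) P)) w)
                (subst (λ Q → _ ∼[ set ] (tv α ≐ τ) ∷ Q)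
                  (sym (equations-eliminated inv acyclic)) Q∼)
    continue : Dec (Any (α occursInEq_) (equations B ++ P)) → Result _
    continue (yes o) = after (eliminate (P₀∼ , new) o acyclic) (next SetEq.refl)
    -- Here `eliminate` does not apply: the equation is already solved, and substituting for `α` is
    -- the identity on the others.
    continue (no ∄)  = next (subst (λ Q → _ ∼[ set ] (tv α ≐ τ) ∷ Q)
                         (sym (map-id-local (All.map (λ {e} → ≔-unusedEq e) (¬Any⇒All¬ _ ∄)))) P₀∼)

  -- The unifier `θ` factors through the solved form with `θ` itself as the other factor, since `θ`
  -- satisfies every binding.
  good-absorbs : ∀ {B} → All Good (equations B) → ∀ τ → θ ⟨ apply B τ ⟩₀ ≡ θ ⟨ τ ⟩₀
  good-absorbs g (τ ⊸ τ′) = cong₂ _⊸_ (good-absorbs g τ) (good-absorbs g τ′)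
  good-absorbs {[]} [] (tv α) = refl
  good-absorbs {(β , _) ∷ _} (g ∷ gs) (tv α) with α ≟ β
  ... | yes refl rewrite dec-true (α ≟ α) refl = sym (proj₁ g)
  ... | no α≢β   rewrite dec-false (α ≟ β) α≢β = good-absorbs gs (tv α)

  good-over : ∀ {B τ} → All Good (equations B) → τ over V → apply B τ over V
  good-over g (p ⊸ q) = good-over g p ⊸ good-over g q
  good-over {[]} [] (tv α∈V) = tv α∈V
  good-over {(β , _) ∷ _} (g ∷ gs) (tv {α = α} α∈V) with α ≟ β
  ... | yes refl rewrite dec-true (α ≟ α) refl = proj₂ (proj₂ g)
  ... | no α≢β   rewrite dec-false (α ≟ β) α≢β = good-over gs (tv α∈V)

  record Solution (P : Problem) : Set where
    field
      S          : Subst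
      {b}        : ℕ
      run        : UNIFYQ P S b
      absorbs    : ∀ τ → θ ⟨ S ⟨ τ ⟩₀ ⟩₀ ≡ θ ⟨ τ ⟩₀
      stays-over : ∀ {τ} → τ over V → S ⟨ τ ⟩₀ over V

  solution : ∀ {P} → All Good P → Solution P
  solution {P} g with unify (suc (weight P)) (invariant [] [] [] [] g) ℕ.≤-refl SetEq.refl
  ... | S , _ , run , gs =
    record { S = S ; run = run ; absorbs = good-absorbs gs ; stays-over = good-over gs }

-- Completeness of type inference

-- Permutations survive filtering: keeping the key `x` gives the first claim, dropping it the
-- second.
split-↭ : ∀ {x τs₁ τs₂ Δ₁ Δ₂} → x ∉ dom Δ₁ → x ∉ dom Δ₂ →
  List.map (x ,_) τs₁ ++ Δ₁ ↭ List.map (x ,_) τs₂ ++ Δ₂ → τs₁ ↭ τs₂ × Δ₁ ↭ Δ₂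
split-↭ {x} {τs₁} {τs₂} {Δ₁} {Δ₂} x∉₁ x∉₂ p =
  subst₂ _↭_ (values τs₁) (values τs₂)
    (↭.map⁺ proj₂ (subst₂ _↭_ (same τs₁ x∉₁) (same τs₂ x∉₂) (↭.filter-↭ is? p))) ,
  subst₂ _↭_ (other τs₁ x∉₁) (other τs₂ x∉₂) (↭.filter-↭ (¬? ∘ is?) p)
  where
  is? = λ (d : Var × L₀) → x ≟ proj₁ d
  values : ∀ τs → List.map proj₂ (List.map (x ,_) τs) ≡ τs
  values τs = trans (sym (map-∘ τs)) (map-id τs)
  same : ∀ τs {Δ} → x ∉ dom Δ → filter is? (List.map (x ,_) τs ++ Δ) ≡ List.map (x ,_) τs
  same τs {Δ} x∉ = trans (filter-++ is? (List.map (x ,_) τs) Δ)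
    (trans (cong₂ _++_ (filter-all is? (All.map⁺ (All.universal (λ _ → refl) τs)))
                       (filter-none is? (All.map⁻ (¬Any⇒All¬ _ x∉))))
           (++-identityʳ _))
  other : ∀ τs {Δ} → x ∉ dom Δ → filter (¬? ∘ is?) (List.map (x ,_) τs ++ Δ) ≡ Δ
  other τs {Δ} x∉ = trans (filter-++ (¬? ∘ is?) (List.map (x ,_) τs) Δ)
    (cong₂ _++_ (filter-none (¬? ∘ is?) (All.map⁺ {f = x ,_} (All.universal (λ _ ¬p → ¬p refl) τs)))
                (filter-all (¬? ∘ is?) (All.map⁻ (¬Any⇒All¬ _ x∉))))

remove-absent : ∀ {A : Set} {x} (Γ : Decls A) → x ∉ dom (remove x Γ)
remove-absent {x = x} Γ p with _ , q ← ∈-dom⁻ p =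
  proj₂ (∈-filter⁻ (λ d → ¬? (x ≟ proj₁ d)) {xs = Γ} q) refl

flat⁺ : Env₁ → FlatEnv
flat⁺ = flat toList

flat-linear : ∀ Γ → flat⁺ (linear Γ) ≡ flat types Γ
flat-linear []      = refl
flat-linear ((x , τ⃗ , _) ∷ Γ) = cong (List.map (x ,_) (toList τ⃗) ++_) (flat-linear Γ)

-- Intersections are non-empty, so every declared variable remains visible after flattening; by
-- consistency, all its types then come from a single declaration on each side.
flat-injective : ∀ {Γ Γ′} → Consistent Γ → Consistent Γ′ → flat⁺ Γ ↭ flat⁺ Γ′ → Γ ≡ᴱ Γ′
flat-injective {[]} {[]} _ _ _ = Homogeneous.refl []
flat-injective {[]} {_ ∷ _} _ _ p with () ← ↭.↭-empty-inv (↭-sym p)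
flat-injective {(x , τ⃗) ∷ Γ} {Γ′} c@(_ ∷ c₁) c′ p
  with τ⃗′ , q ← ∈-dom⁻ (dom-flat toList Γ′ (∈-map⁺ proj₁ (↭.∈-resp-↭ p (here refl))))
  with τ⃗↭ , Γ↭ ← split-↭ {x} {toList τ⃗} {toList τ⃗′} (Unique[x∷xs]⇒x∉xs c ∘ dom-flat toList Γ)
                   (remove-absent Γ′ ∘ dom-flat toList (remove x Γ′))
                   (↭-trans p (flat-remove toList c′ q)) =
  Homogeneous.trans (Homogeneous.prep (refl , τ⃗↭) (flat-injective c₁ (filter-consistent _ c′) Γ↭))
    (Homogeneous.map (λ { refl → refl , ↭-refl }) (↭⇒↭ₛ (↭-sym (remove-↭ c′ q))))

-- Instances of types and extension of substitutions

infix 4 _over₂_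

data _over₂_ : L₂ → List TVar → Set where
  tv  : ∀ {V α} → α ∈ V → tv α over₂ V
  _⊸_ : ∀ {V τ σ} → τ over V → σ over₂ V → (τ ⊸ σ) over₂ V
  _⇒_ : ∀ {V n} {τs : Vec L₀ (2 + n)} {σ} →
        All (_over V) (Vec.toList τs) → σ over₂ V → (τs ⇒ σ) over₂ V

over-mono : ∀ {V V′} → V ⊆ V′ → ∀ {τ} → τ over V → τ over V′
over-mono V⊆ (tv α∈) = tv (V⊆ α∈)
over-mono V⊆ (p ⊸ q) = over-mono V⊆ p ⊸ over-mono V⊆ q

over₂-mono : ∀ {V V′} → V ⊆ V′ → ∀ {σ} → σ over₂ V → σ over₂ V′
over₂-mono V⊆ (tv α∈)  = tv (V⊆ α∈)
over₂-mono V⊆ (p ⊸ q)  = over-mono V⊆ p ⊸ over₂-mono V⊆ q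
over₂-mono V⊆ (ps ⇒ q) = All.map (over-mono V⊆) ps ⇒ over₂-mono V⊆ q

over-⌈⌉ : ∀ {V τ} → τ over V → ⌈ τ ⌉ over₂ V
over-⌈⌉ (tv α∈) = tv α∈
over-⌈⌉ (p ⊸ q) = p ⊸ over-⌈⌉ q

⟨⌈⌉⟩ : ∀ θ τ → θ ⟨ ⌈ τ ⌉ ⟩₂ ≡ ⌈ θ ⟨ τ ⟩₀ ⌉
⟨⌈⌉⟩ θ (tv α)   = refl
⟨⌈⌉⟩ θ (τ ⊸ τ′) = cong (_ ⊸_) (⟨⌈⌉⟩ θ τ′)

-- A linear type contains no intersection that could be permuted.
≈₂-⌈⌉ : ∀ {τ σ} → ⌈ τ ⌉ ≈₂ σ → ⌈ τ ⌉ ≡ σ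
≈₂-⌈⌉ {tv _}  tv      = refl
≈₂-⌈⌉ {_ ⊸ _} (_ ⊸ p) = cong (_ ⊸_) (≈₂-⌈⌉ p)

⌈⌉-injective : ∀ {τ τ′} → ⌈ τ ⌉ ≡ ⌈ τ′ ⌉ → τ ≡ τ′
⌈⌉-injective {tv _}  {tv _}  refl = refl
⌈⌉-injective {_ ⊸ _} {_ ⊸ _} eq   = go eq
  where
  go : ∀ {τ₁ τ₂ τ₁′ τ₂′} →
       _≡_ {A = L₂} (τ₁ ⊸ ⌈ τ₂ ⌉) (τ₁′ ⊸ ⌈ τ₂′ ⌉) → _≡_ {A = L₀} (τ₁ ⊸ τ₂) (τ₁′ ⊸ τ₂′)
  go {τ₂ = τ₂} {τ₂′ = τ₂′} eq with ⌈ τ₂ ⌉ in eq₁ | ⌈ τ₂′ ⌉ in eq₂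
  go refl | _ | _ = cong (_ ⊸_) (⌈⌉-injective (trans eq₁ (sym eq₂)))

≈₂-trans : ∀ {σ₁ σ₂ σ₃} → σ₁ ≈₂ σ₂ → σ₂ ≈₂ σ₃ → σ₁ ≈₂ σ₃
≈₂-trans tv      tv        = tv
≈₂-trans (_ ⊸ p) (_ ⊸ q)   = _ ⊸ ≈₂-trans p q
≈₂-trans (p ⇒ q) (p′ ⇒ q′) = ↭-trans p p′ ⇒ ≈₂-trans q q′

module _ (θ S : Subst) (absorbs : ∀ τ → θ ⟨ S ⟨ τ ⟩₀ ⟩₀ ≡ θ ⟨ τ ⟩₀) where

  absorbs₂ : ∀ σ → θ ⟨ S ⟨ σ ⟩₂ ⟩₂ ≈₂ θ ⟨ σ ⟩₂
  absorbs₂ (tv α) =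
    subst (_≈₂ _) (sym (trans (⟨⌈⌉⟩ θ (S ⟨ tv α ⟩₀)) (cong ⌈_⌉ (absorbs (tv α))))) ≈₂-refl
  absorbs₂ (τ ⊸ σ) rewrite absorbs τ = _ ⊸ absorbs₂ σ
  absorbs₂ (τs ⇒ σ) = ↭-reflexive (cong (toList ∘ fromVec) (go τs)) ⇒ absorbs₂ σ
    where
    go : ∀ {n} (τs : Vec L₀ n) → Vec.map (θ ⟨_⟩₀) (Vec.map (S ⟨_⟩₀) τs) ≡ Vec.map (θ ⟨_⟩₀) τs
    go []       = refl
    go (τ ∷ τs) = cong₂ _∷_ (absorbs τ) (go τs)

module _ {V : List TVar} (S : Subst) (stays-over : ∀ {τ} → τ over V → S ⟨ τ ⟩₀ over V) where

  stays-over₂ : ∀ {σ} → σ over₂ V → S ⟨ σ ⟩₂ over₂ V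
  stays-over₂ (tv α∈) = over-⌈⌉ (stays-over (tv α∈))
  stays-over₂ (p ⊸ q) = stays-over p ⊸ stays-over₂ q
  stays-over₂ (_⇒_ {τs = τs} ps q) =
    subst (All (_over V)) (sym (toList-map (S ⟨_⟩₀) τs)) (All.map⁺ (All.map stays-over ps))
    ⇒ stays-over₂ q

module _ {V : List TVar} {θ θ′ : Subst}
  (agree : ∀ {α} → α ∈ V → θ′ ⟨ tv α ⟩₀ ≡ θ ⟨ tv α ⟩₀) where

  agree₀ : ∀ {τ} → τ over V → θ′ ⟨ τ ⟩₀ ≡ θ ⟨ τ ⟩₀
  agree₀ (tv α∈) = agree α∈
  agree₀ (p ⊸ q) = cong₂ _⊸_ (agree₀ p) (agree₀ q)

  agree* : ∀ {n} {τs : Vec L₀ n} → All (_over V) (Vec.toList τs) →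
    Vec.map (θ′ ⟨_⟩₀) τs ≡ Vec.map (θ ⟨_⟩₀) τs
  agree* {τs = []}     []       = refl
  agree* {τs = _ ∷ _} (p ∷ ps) = cong₂ _∷_ (agree₀ p) (agree* ps)

  agree₂ : ∀ {σ} → σ over₂ V → θ′ ⟨ σ ⟩₂ ≡ θ ⟨ σ ⟩₂
  agree₂ (tv α∈)  = cong ⌈_⌉ (agree α∈)
  agree₂ (p ⊸ q)  = cong₂ _⊸_ (agree₀ p) (agree₂ q)
  agree₂ (ps ⇒ q) = cong₂ _⇒_ (agree* ps) (agree₂ q)

instᴱ : Subst → FlatEnv → FlatEnv
instᴱ θ = List.map (map₂ (θ ⟨_⟩₀))

flat-⟨⟩ : ∀ θ Γ → flat⁺ (θ ⟨ Γ ⟩ᴱ) ≡ instᴱ θ (flat⁺ Γ)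
flat-⟨⟩ θ [] = refl
flat-⟨⟩ θ ((x , τ ∷ τs) ∷ Γ) = cong (_ ∷_) (trans
  (cong₂ _++_ (trans (sym (map-∘ τs)) (map-∘ τs)) (flat-⟨⟩ θ Γ))
  (sym (map-++ _ (List.map (x ,_) τs) _)))

record Extends (V : List TVar) (θ : Subst) (V′ : List TVar) (θ′ : Subst) : Set where
  constructor extends
  field
    V⊆    : V ⊆ V′
    agree : ∀ {α} → α ∈ V → θ′ ⟨ tv α ⟩₀ ≡ θ ⟨ tv α ⟩₀

Extends-refl : ∀ {V θ} → Extends V θ V θ
Extends-refl = extends id (λ _ → refl)

Extends-trans : ∀ {V₁ V₂ V₃ θ₁ θ₂ θ₃} →
  Extends V₁ θ₁ V₂ θ₂ → Extends V₂ θ₂ V₃ θ₃ → Extends V₁ θ₁ V₃ θ₃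
Extends-trans (extends V⊆ a) (extends V⊆′ a′) = extends (V⊆′ ∘ V⊆) (λ p → trans (a′ (V⊆ p)) (a p))

record NewVariable (V : List TVar) (θ : Subst) (τ : L₀) : Set where
  field
    {α}   : TVar
    α∉V   : α ∉ V
    θ′    : Subst
    value : θ′ ⟨ tv α ⟩₀ ≡ τ
    ext   : Extends V θ (α ∷ V) θ′

newVariable : ∀ V θ τ → NewVariable V θ τ
-- Avoiding `V` makes the variable new; avoiding the domain of `θ` keeps the bindings distinct.
newVariable V θ τ with α , α∉ ← fresh (V ++ dom (bindings θ)) = record
  { α∉V   = α∉ ∘ ∈-++⁺ˡ
  ; θ′    = ⟪ (α , τ) ∷ bindings θ , ¬Any⇒All¬ _ (α∉ ∘ ∈-++⁺ʳ V) ∷ distinct θ ⟫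
  ; value = value
  ; ext   = extends there old
  }
  where
  value : apply ((α , τ) ∷ bindings θ) (tv α) ≡ τ
  value rewrite dec-true (α ≟ α) refl = refl
  old : ∀ {β} → β ∈ V → apply ((α , τ) ∷ bindings θ) (tv β) ≡ θ ⟨ tv β ⟩₀
  old {β} β∈ rewrite dec-false (β ≟ α) (λ { refl → α∉ (∈-++⁺ˡ β∈) }) = refl

-- Inferred data whose instances are the derived ones

record MatchesEnv (V : List TVar) (θ : Subst) (Γ : Env₁) (Δ : FlatEnv) : Set where
  constructor matchesEnv
  field
    consistent : Consistent Γ
    isOver     : All (λ (_ , τ) → τ over V) (flat⁺ Γ)
    inst       : instᴱ θ (flat⁺ Γ) ↭ Δ

record Matches₂ (V : List TVar) (θ : Subst) (σ′ σ : L₂) : Set where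
  constructor matches₂
  field
    isOver : σ′ over₂ V
    inst   : θ ⟨ σ′ ⟩₂ ≈₂ σ

record Matches₀ (V : List TVar) (θ : Subst) (τ′ τ : L₀) : Set where
  constructor matches₀
  field
    isOver : τ′ over V
    inst   : θ ⟨ τ′ ⟩₀ ≡ τ

data MatchesEnvs (V : List TVar) (θ : Subst) : ∀ {n} → Vec Env₁ n → FlatEnv → Set where
  []  : MatchesEnvs V θ [] []
  _∷_ : ∀ {n Γ Δ Δs} {Γs : Vec Env₁ n} →
        MatchesEnv V θ Γ Δ → MatchesEnvs V θ Γs Δs → MatchesEnvs V θ (Γ ∷ Γs) (Δ ++ Δs)

module _ {V V′ : List TVar} {θ θ′ : Subst} (ext : Extends V θ V′ θ′) where

  open Extends ext

  weakenᴱ : ∀ {Γ Δ} → MatchesEnv V θ Γ Δ → MatchesEnv V′ θ′ Γ Δ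
  weakenᴱ (matchesEnv c o i) = matchesEnv c (All.map (over-mono V⊆) o)
    (subst (_↭ _)
      (map-cong-local (All.map (λ p → cong (_ ,_) (sym (agree₀ {θ = θ} {θ′} agree p))) o)) i)

  weaken₂ : ∀ {σ′ σ} → Matches₂ V θ σ′ σ → Matches₂ V′ θ′ σ′ σ
  weaken₂ (matches₂ o i) =
    matches₂ (over₂-mono V⊆ o) (subst (_≈₂ _) (sym (agree₂ {θ = θ} {θ′} agree o)) i)

  weaken₀ : ∀ {τ′ τ} → Matches₀ V θ τ′ τ → Matches₀ V′ θ′ τ′ τ
  weaken₀ (matches₀ o i) = matches₀ (over-mono V⊆ o) (trans (agree₀ {θ = θ} {θ′} agree o) i)

  weaken* : ∀ {n} {Γs : Vec Env₁ n} {Δ} → MatchesEnvs V θ Γs Δ → MatchesEnvs V′ θ′ Γs Δ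
  weaken* []       = []
  weaken* (m ∷ ms) = weakenᴱ m ∷ weaken* ms

module _ {V : List TVar} {θ : Subst} where

  matches-↭ : ∀ {Γ Δ Δ′} → Δ ↭ Δ′ → MatchesEnv V θ Γ Δ → MatchesEnv V θ Γ Δ′
  matches-↭ p (matchesEnv c o i) = matchesEnv c o (↭-trans i p)

  matches-⊕ : ∀ {Γ₁ Γ₂ Δ₁ Δ₂} → MatchesEnv V θ Γ₁ Δ₁ → MatchesEnv V θ Γ₂ Δ₂ →
    MatchesEnv V θ (Γ₁ ⊕₁ Γ₂) (Δ₁ ++ Δ₂)
  matches-⊕ {Γ₁} {Γ₂} (matchesEnv c₁ o₁ i₁) (matchesEnv c₂ o₂ i₂) = matchesEnv
    (Merge.merge-consistent _⁺++⁺_ Γ₁ c₁ c₂)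
    (↭.All-resp-↭ (↭-sym flat-⊕) (All.++⁺ o₁ o₂))
    (↭-trans (↭.map⁺ _ flat-⊕) (subst (_↭ _) (sym (map-++ _ (flat⁺ Γ₁) (flat⁺ Γ₂))) (↭.++⁺ i₁ i₂)))
    where
    flat-⊕ : flat⁺ (Γ₁ ⊕₁ Γ₂) ↭ flat⁺ Γ₁ ++ flat⁺ Γ₂
    flat-⊕ = Merge.flat-merge _⁺++⁺_ toList toList-⁺++⁺ c₁ c₂

  matches-⨁ : ∀ {n} {Γs : Vec Env₁ (suc n)} {Δ} → MatchesEnvs V θ Γs Δ → MatchesEnv V θ (⨁₁ Γs) Δ
  matches-⨁ (_∷_ {Δ = Δ} m [])      = matches-↭ (↭-sym (↭.++-identityʳ Δ)) m
  matches-⨁ (m ∷ ms@(_ ∷ _)) = matches-⊕ m (matches-⨁ ms)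

  -- Instantiation preserves intersection arrows, so a type with a linear instance is itself linear.
  -- Thus the type inferred for an argument can enter a unification problem.
  matches-⌈⌉ : ∀ σ′ {τ} → Matches₂ V θ σ′ ⌈ τ ⌉ → ∃[ τ′ ] σ′ ≡ ⌈ τ′ ⌉ × Matches₀ V θ τ′ τ
  matches-⌈⌉ (tv α) (matches₂ (tv α∈) i) =
    tv α , refl , matches₀ (tv α∈) (⌈⌉-injective (≈₂-⌈⌉ {θ ⟨ tv α ⟩₀} i))
  matches-⌈⌉ (τ₁ ⊸ σ) {_ ⊸ _} (matches₂ (p ⊸ q) (_ ⊸ i))
    with τ₂ , refl , matches₀ q′ i′ ← matches-⌈⌉ σ (matches₂ q i) =
    τ₁ ⊸ τ₂ , refl , matches₀ (p ⊸ q′) (cong (_ ⊸_) i′)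
  matches-⌈⌉ (τ₁ ⊸ σ) {tv _} (matches₂ _ ())
  matches-⌈⌉ (τs ⇒ σ) {tv _} (matches₂ _ ())
  matches-⌈⌉ (τs ⇒ σ) {_ ⊸ _} (matches₂ _ ())

  module _ {P : Problem} (sol : Unification.Solution θ V P) where

    open Unification.Solution sol

    matches-⟨⟩ᴱ : ∀ {Γ Δ} → MatchesEnv V θ Γ Δ → MatchesEnv V θ (S ⟨ Γ ⟩ᴱ) Δ
    matches-⟨⟩ᴱ {Γ} (matchesEnv c o i) = matchesEnv
      (subst Unique (map-∘ Γ) c)
      (subst (All _) (sym (flat-⟨⟩ S Γ)) (All.map⁺ (All.map stays-over o)))
      (subst (_↭ _) (sym (trans (cong (instᴱ θ) (flat-⟨⟩ S Γ)) (trans (sym (map-∘ (flat⁺ Γ)))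
        (map-cong (λ d → cong (_ ,_) (absorbs (proj₂ d))) (flat⁺ Γ))))) i)

    matches-⟨⟩₂ : ∀ {σ′ σ} → Matches₂ V θ σ′ σ → Matches₂ V θ (S ⟨ σ′ ⟩₂) σ
    matches-⟨⟩₂ {σ′} (matches₂ o i) =
      matches₂ (stays-over₂ S stays-over o) (≈₂-trans (absorbs₂ θ S absorbs σ′) i)

  -- The block of `x` is non-empty, so `x` is declared in `Γ` and inference cannot fail at the
  -- abstraction. As `Δ` does not declare `x`, the block is exactly the instance of that one
  -- declaration.
  matches-bind : ∀ {x τ τs Γ Δ} → MatchesEnv V θ Γ (Δ ++ List.map (x ,_) (τ ∷ τs)) → x ∉ dom Δ →
    ∃[ τ⃗ ] (x , τ⃗) ∈ Γ × All (_over V) (toList τ⃗) ×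
      List.map (θ ⟨_⟩₀) (toList τ⃗) ↭ τ ∷ τs × MatchesEnv V θ (remove x Γ) Δ
  matches-bind {x} {τ} {τs} {Γ} {Δ} (matchesEnv c o i) x∉Δ =
    τ⃗ , τ⃗∈ , All.map⁻ (All.++⁻ˡ X o′) , proj₁ split ,
    matchesEnv (filter-consistent _ c) (All.++⁻ʳ X o′) (proj₂ split)
    where
    dom-inst : ∀ {y} → y ∈ dom (instᴱ θ (flat⁺ Γ)) → y ∈ dom Γ
    dom-inst p = dom-flat toList Γ (subst (_ ∈_) (sym (map-∘ (flat⁺ Γ))) p)
    found = ∈-dom⁻ (dom-inst (∈-map⁺ proj₁ (↭.∈-resp-↭ (↭-sym i) (∈-++⁺ʳ Δ (here refl)))))
    τ⃗ = proj₁ found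
    τ⃗∈ = proj₂ found
    X = List.map (x ,_) (toList τ⃗)
    removed = flat-remove toList c τ⃗∈
    o′ = ↭.All-resp-↭ removed o
    X-inst : instᴱ θ (X ++ flat⁺ (remove x Γ)) ≡
             List.map (x ,_) (List.map (θ ⟨_⟩₀) (toList τ⃗)) ++ instᴱ θ (flat⁺ (remove x Γ))
    X-inst = trans (map-++ _ X _)
      (cong (_++ instᴱ θ (flat⁺ (remove x Γ)))
        (trans (sym (map-∘ (toList τ⃗))) (map-∘ (toList τ⃗))))
    split = split-↭ {x}
      (λ p → remove-absent Γ (dom-flat toList (remove x Γ)
               (subst (x ∈_) (sym (map-∘ (flat⁺ (remove x Γ)))) p)))
      x∉Δ
      (↭-trans (↭-reflexive (sym X-inst)) (↭-trans (↭.map⁺ _ (↭-sym removed))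
        (↭-trans i (↭.++-comm Δ (List.map (x ,_) (τ ∷ τs))))))

-- Induction over the syntax-directed system

record Inference (V : List TVar) (θ : Subst) (Δ : FlatEnv) (M : Λ) (σ : L₂) : Set where
  constructor inference
  field
    {Γ′} : Env₁
    {σ′} : L₂
    {b}  : ℕ
    {V′} : List TVar
    {θ′} : Subst
    run  : V ⊢ M ↦ (Γ′ , σ′ , b) ⊣ V′
    ext  : Extends V θ V′ θ′
    env  : MatchesEnv V′ θ′ Γ′ Δ
    type : Matches₂ V′ θ′ σ′ σ

record Inferences {n} (V : List TVar) (θ : Subst) (Δ : FlatEnv) (M : Λ) (τs : Vec L₀ n) : Set where
  constructor inferences
  field
    {Γs}  : Vec Env₁ n
    {τs′} : Vec L₀ n
    {bs}  : Vec ℕ n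
    {V′}  : List TVar
    {θ′}  : Subst
    runs  : V ⊢ M ↦* (Γs , τs′ , bs) ⊣ V′
    ext   : Extends V θ V′ θ′
    envs  : MatchesEnvs V′ θ′ Γs Δ
    match : Pointwiseᵛ.Pointwise (Matches₀ V′ θ′) τs′ τs

-- Starting from an arbitrary θ on the variables used so far makes separate calls
-- composable: each call extends the substitution found by the previous ones.
Complete : FlatEnv → Λ → L₂ → Set
Complete Δ M σ = ∀ V θ → Inference V θ Δ M σ

-- Collects the induction hypotheses for the copies of an argument instead of their derivations, so
-- that they can be reordered without disturbing the structural recursion.
data Complete* (M : Λ) : FlatEnv → List L₀ → Set where
  []  : Complete* M [] []
  _∷_ : ∀ {Δ Δs τ τs} → Complete Δ M ⌈ τ ⌉ → Complete* M Δs τs → Complete* M (Δ ++ Δs) (τ ∷ τs)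

-- The inferred type of a function lists its intersection in an order of its own, which the calls on
-- the argument have to follow.
Complete*-resp-↭ : ∀ {M Δ τs τs′} → τs ↭ τs′ → Complete* M Δ τs →
  ∃[ Δ′ ] Δ ↭ Δ′ × Complete* M Δ′ τs′
Complete*-resp-↭ ↭.refl cs = _ , ↭-refl , cs
Complete*-resp-↭ (↭.prep _ p) (_∷_ {Δ} c cs) with _ , q , cs′ ← Complete*-resp-↭ p cs =
  _ , ↭.++⁺ˡ Δ q , c ∷ cs′
Complete*-resp-↭ (↭.swap _ _ p) (_∷_ {Δ₁} c₁ (_∷_ {Δ₂} c₂ cs))
  with _ , q , cs′ ← Complete*-resp-↭ p cs =
  _ , ↭-trans (↭.shifts Δ₁ Δ₂) (↭.++⁺ˡ Δ₂ (↭.++⁺ˡ Δ₁ q)) , c₂ ∷ c₁ ∷ cs′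
Complete*-resp-↭ (↭.trans p p′) cs
  with _ , q , cs′ ← Complete*-resp-↭ p cs
  with _ , q′ , cs″ ← Complete*-resp-↭ p′ cs′ = _ , ↭-trans q q′ , cs″

infer* : ∀ {n M Δ} (τs : Vec L₀ n) → Complete* M Δ (Vec.toList τs) → ∀ V θ → Inferences V θ Δ M τs
infer* [] [] V θ = inferences [] Extends-refl [] []
infer* (τ ∷ τs) (c ∷ cs) V θ
  with inference {σ′ = σ′} {V′ = V₁} {θ₁} run ext env type ← c V θ
  with _ , refl , m ← matches-⌈⌉ σ′ type
  with inferences runs ext′ envs ms ← infer* τs cs V₁ θ₁ =
  inferences (run ∷ runs) (Extends-trans ext ext′)
    (weakenᴱ ext′ env ∷ envs) (weaken₀ ext′ m ∷ ms)

complete-var : ∀ {x τ} → Complete ((x , τ) ∷ []) (free x) ⌈ τ ⌉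
complete-var {x} {τ} V θ = inference (var α∉V) ext
  (matchesEnv ([] ∷ []) (tv (here refl) ∷ []) (↭-reflexive (cong (λ τ → (x , τ) ∷ []) value)))
  (matches₂ (tv (here refl)) (subst (λ τ′ → ⌈ τ′ ⌉ ≈₂ ⌈ τ ⌉) (sym value) ≈₂-refl))
  where open NewVariable (newVariable V θ τ)

complete-abs-⊸ : ∀ {Δ x M τ σ} → x ∉ dom Δ →
  Complete (Δ ++ (x , τ) ∷ []) M σ → Complete Δ (ƛ x M) (τ ⊸ σ)
complete-abs-⊸ x∉ c V θ
  with inference run ext env (matches₂ o i) ← c V θ
  with matches-bind env x∉
-- Instantiation preserves the number of types in an intersection, so inference is in the linear
-- case whenever the derivation is.
... | τ′ ∷ τs′ , τ⃗∈ , p ∷ _ , q , env′ with τs′ | ↭.↭-singleton-inv q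
...   | [] | refl = inference (abs-⊸ run τ⃗∈) ext env′ (matches₂ (p ⊸ o) (_ ⊸ i))

complete-abs-⇒ : ∀ {n Δ x M σ} {τs : Vec L₀ (2 + n)} → x ∉ dom Δ →
  Complete (Δ ++ List.map (x ,_) (Vec.toList τs)) M σ → Complete Δ (ƛ x M) (τs ⇒ σ)
complete-abs-⇒ {τs = τ₁ ∷ τ₂ ∷ τs} x∉ c V θ
  with inference {θ′ = θ′} run ext env (matches₂ o i) ← c V θ
  with matches-bind env x∉
... | τ′ ∷ [] , _ , _ , q , _ with () ← ↭.↭-singleton-inv (↭-sym q)
... | τ₁′ ∷ τ₂′ ∷ τs′ , τ⃗∈ , ps , q , env′ = inference
  (abs-⇒ {τs = τs″} run
    (subst (λ τs → (_ , τ₁′ ∷ τ₂′ ∷ τs) ∈ _) (sym (toList∘fromList τs′)) τ⃗∈)) ext env′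
  (matches₂ (subst (λ τs → All _ (τ₁′ ∷ τ₂′ ∷ τs)) (sym (toList∘fromList τs′)) ps ⇒ o)
    (subst (λ τs → θ′ ⟨ τ₁′ ⟩₀ ∷ θ′ ⟨ τ₂′ ⟩₀ ∷ τs ↭ _)
      (sym (trans (toList-map (θ′ ⟨_⟩₀) (Vec.fromList τs′))
                  (cong (List.map (θ′ ⟨_⟩₀)) (toList∘fromList τs′)))) q ⇒ i))
  where
  τs″ = τ₁′ ∷ τ₂′ ∷ Vec.fromList τs′

complete-app-⊸ : ∀ {Δ₁ Δ₂ M₁ M₂ τ σ} →
  Complete Δ₁ M₁ (τ ⊸ σ) → Complete Δ₂ M₂ ⌈ τ ⌉ → Complete (Δ₁ ++ Δ₂) (M₁ · M₂) σ
complete-app-⊸ {τ = τ} c₁ c₂ V θ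
  with inference {σ′ = σ₁} {V′ = V₁} {θ₁} run₁ ext₁ env₁ type₁ ← c₁ V θ
  with inference {σ′ = σ₂} {V′ = V₂} {θ₂} run₂ ext₂ env₂ type₂ ← c₂ V₁ θ₁
  with τ₂ , refl , matches₀ o₂ i₂ ← matches-⌈⌉ σ₂ type₂
  with σ₁ | type₁
... | τ₁ ⊸ σ₁′ | matches₂ (p ⊸ q) (_ ⊸ i)
  with sol ← Unification.solution θ₂ V₂
         ((trans i₂ (sym (agree₀ {θ = θ₁} {θ₂} (Extends.agree ext₂) p)) , o₂
         , over-mono (Extends.V⊆ ext₂) p) ∷ []) =
  inference (app-⊸ run₁ run₂ (Unification.Solution.run sol)) (Extends-trans ext₁ ext₂)
    (matches-⟨⟩ᴱ sol (matches-⊕ (weakenᴱ ext₂ env₁) env₂))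
    (matches-⟨⟩₂ sol (weaken₂ ext₂ (matches₂ q i)))
... | tv α₁ | matches₂ (tv α₁∈) i with θ₁ ⟨ tv α₁ ⟩₀ in eq
-- The instance of `α₁` matches `τ ⊸ σ`, so it is a linear arrow with domain `τ`; its codomain `τ₃`
-- represents `σ`.
...   | _ ⊸ τ₃ with _ ⊸ i′ ← i =
  inference (app-var {S = Sol.S} run₁ run₂ A₂.α∉V A₃.α∉V Sol.run)
    (Extends-trans ext₁ (Extends-trans ext₂ ext₃))
    (matches-⟨⟩ᴱ sol (matches-⊕ (weakenᴱ (Extends-trans ext₂ ext₃) env₁) (weakenᴱ ext₃ env₂)))
    (matches-⟨⟩₂ sol {σ′ = tv A₃.α}
      (matches₂ (tv (here refl)) (subst (λ τ → ⌈ τ ⌉ ≈₂ _) (sym A₃.value) i′)))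
  where
  -- The new variables receive the domain and codomain just found, which makes the extended
  -- substitution satisfy both equations.
  module A₂ = NewVariable (newVariable V₂ θ₂ τ)
  module A₃ = NewVariable (newVariable (A₂.α ∷ V₂) A₂.θ′ τ₃)
  ext₃ = Extends-trans A₂.ext A₃.ext
  V₃ = A₃.α ∷ A₂.α ∷ V₂
  α₂≡ : A₃.θ′ ⟨ tv A₂.α ⟩₀ ≡ τ
  α₂≡ = trans (Extends.agree A₃.ext (here refl)) A₂.value
  sol = Unification.solution A₃.θ′ V₃ {(tv α₁ ≐ tv A₂.α ⊸ tv A₃.α) ∷ (τ₂ ≐ tv A₂.α) ∷ []}
    ( ( trans (Extends.agree (Extends-trans ext₂ ext₃) α₁∈)
              (trans eq (sym (cong₂ _⊸_ α₂≡ A₃.value)))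
      , tv (Extends.V⊆ (Extends-trans ext₂ ext₃) α₁∈) , tv (there (here refl)) ⊸ tv (here refl))
    ∷ ( trans (agree₀ {θ = θ₂} {A₃.θ′} (Extends.agree ext₃) o₂) (trans i₂ (sym α₂≡))
      , over-mono (Extends.V⊆ ext₃) o₂ , tv (there (here refl)))
    ∷ [])
  module Sol = Unification.Solution sol

good-zipWith : ∀ {n V θ} {τs τs′ ρs : Vec L₀ n} → Pointwiseᵛ.Pointwise (Matches₀ V θ) τs ρs →
  Vec.map (θ ⟨_⟩₀) τs′ ≡ ρs → All (_over V) (Vec.toList τs′) →
  All (Unification.Good θ V) (Vec.toList (Vec.zipWith _≐_ τs τs′))
good-zipWith {τs′ = []}    []                  _    []       = []
good-zipWith {τs′ = _ ∷ _} (matches₀ o i ∷ ms) refl (p ∷ ps) = (i , o , p) ∷ good-zipWith ms refl ps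

complete-app-⇒ : ∀ {n Δ₁ Δ₂ M₁ M₂ σ} {τs : Vec L₀ (2 + n)} →
  Complete Δ₁ M₁ (τs ⇒ σ) → Complete* M₂ Δ₂ (Vec.toList τs) → Complete (Δ₁ ++ Δ₂) (M₁ · M₂) σ
complete-app-⇒ {Δ₁ = Δ₁} {τs = τs} c₁ cs V θ
  with inference {σ′ = σ₁} {V′ = V₁} {θ₁} run₁ ext₁ env₁ type₁ ← c₁ V θ
  with σ₁ | type₁
-- Variables are instantiated by linear types only, so the intersection arrow must already be
-- present in the inferred type.
... | tv α | matches₂ _ i = ⊥-elim (⌈⌉≉⇒ (θ₁ ⟨ tv α ⟩₀) i)
  where
  ⌈⌉≉⇒ : ∀ τ {n} {τs : Vec L₀ (2 + n)} {σ} → ¬ (⌈ τ ⌉ ≈₂ τs ⇒ σ)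
  ⌈⌉≉⇒ (tv _)  ()
  ⌈⌉≉⇒ (_ ⊸ _) ()
... | _ ⊸ _ | matches₂ _ ()
... | τs′ ⇒ σ₁′ | matches₂ (ps ⇒ q) (τs↭ ⇒ i)
  with _ , Δ↭ , cs′ ← Complete*-resp-↭
         (subst₂ _↭_ (toList-fromVec τs) (toList-fromVec (Vec.map (θ₁ ⟨_⟩₀) τs′)) (↭-sym τs↭)) cs
  with inferences {V′ = V₂} {θ₂} runs ext₂ envs ms ← infer* (Vec.map (θ₁ ⟨_⟩₀) τs′) cs′ V₁ θ₁
  with sol ← Unification.solution θ₂ V₂
         (good-zipWith ms (agree* {θ = θ₁} {θ₂} (Extends.agree ext₂) ps)
           (All.map (over-mono (Extends.V⊆ ext₂)) ps)) =
  inference (app-⇒ run₁ runs (Unification.Solution.run sol)) (Extends-trans ext₁ ext₂)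
    (matches-↭ (↭.++⁺ˡ Δ₁ (↭-sym Δ↭))
      (matches-⟨⟩ᴱ sol (matches-⊕ (weakenᴱ ext₂ env₁) (matches-⨁ envs))))
    (matches-⟨⟩₂ sol (weaken₂ ext₂ (matches₂ q i)))

mutual

  complete : ∀ {Δ M σ} → Δ ⊩ M ∶ σ → Complete Δ M σ
  complete var           = complete-var
  complete (abs-⊸ D x∉)  = complete-abs-⊸ x∉ (complete D)
  complete (abs-⇒ D x∉)  = complete-abs-⇒ x∉ (complete D)
  complete (app-⊸ D E)   = complete-app-⊸ (complete D) (complete E)
  complete (app-⇒ D Es)  = complete-app-⇒ (complete D) (complete* Es)
  complete (conv D Δ↭ σ≈) V θ with inference run ext env (matches₂ o i) ← complete D V θ =
    inference run ext (matches-↭ Δ↭ env) (matches₂ o (≈₂-trans i σ≈))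

  complete* : ∀ {Δ M τs} → Δ ⊩* M ∶ τs → Complete* M Δ τs
  complete* []       = []
  complete* (D ∷ Ds) = complete D ∷ complete* Ds

theorem55 : (M : Λ) (Γ : Env) (b : ℕ) (σ : L₂) (s : Q₂) →
    Γ ⊢[ b ] M ∶ (σ , s) →
    ∃[ Γ′ ] ∃[ σ′ ] ∃[ b′ ]
    Consistent Γ′ × (TQ M ↦ (Γ′ , σ′ , b′)) ×
    (∃[ S ] (S ⟨ σ′ ⟩₂ ≈₂ σ) × (S ⟨ Γ′ ⟩ᴱ ≡ᴱ linear Γ))
theorem55 M Γ b σ s D
  -- No type variable is in use yet, so the empty substitution can start the run; the one reached at
  -- its end is the required witness.
  with inference {Γ′} {σ′} {b′} {V} {S} run _ (matchesEnv c _ Γ′↭) (matches₂ _ σ′≈)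
         ← complete (⊢⇒⊩ D) [] ⟪ [] , [] ⟫ =
  Γ′ , σ′ , b′ , c , (V , run) , S , σ′≈ ,
  flat-injective (subst Unique (map-∘ Γ′) c) (subst Unique (map-∘ Γ) (⊢-consistent D))
    (subst₂ _↭_ (sym (flat-⟨⟩ S Γ′)) (sym (flat-linear Γ)) Γ′↭)
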